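{- Let $\phi=\frac{1+\sqrt5}{2}$. The algorithm Chasing-Local-Opt with precision parameter $\varepsilon\in(0,1)$ maintains a $(\phi+1+9\varepsilon)$-approximation and is $\tilde O(1/\varepsilon)$-consistent. That is, there are absolute constants $c,d>0$ such that for every $\varepsilon\in(0,1)$, every integer $k\ge1$, every finite set $V$, every monotone normalized submodular $f:2^V\to\mathbb{R}_{\ge0}$ and every ordering $e_1,\dots,e_n$ of the elements of $V$, the solutions $S_t$ maintained by Chasing-Local-Opt (for any resolution of its arbitrary choices) satisfy $$(\phi+1+9\varepsilon)\, f(S_t)\ \ge\ f(\mathrm{OPT}_t)\qquad\text{for all } t=1,\dots,n,$$ and $$|S_t\setminus S_{t-1}|\ \le\ \frac{c}{\varepsilon}\Big(1+\log\frac1\varepsilon\Big)^{d}\qquad\text{for all } t=2,\dots,n.$$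
   Context: For a finite set $V$, a function $f:2^V\to\mathbb{R}_{\ge0}$ and $X,Y\subseteq V$, write $f(X\mid Y)=f(X\cup Y)-f(Y)$, and $f(x\mid Y)=f(\{x\}\mid Y)$. $f$ is monotone if $f(e\mid X)\ge 0$ for all $X\subseteq V$, $e\in V$; submodular if $f(e\mid X)\ge f(e\mid Y)$ for all $X\subseteq Y\subseteq V$ and $e\in V\setminus Y$; normalized if $f(\emptyset)=0$. The elements of $V$ arrive one at a time in the order $e_1,\dots,e_n$; $V_t=\{e_1,\dots,e_t\}$, and $\mathrm{OPT}_t$ is a set maximizing $f$ among subsets of $V_t$ of cardinality at most $k$. Subroutine Min-Swap$(S,x)$, for a set $S$ with $|S|\le k$ and an element $x$: if $|S|<k$, return $S\cup\{x\}$; otherwise let $r\in S$ be any element with $f(r\mid S\setminus\{r\})\le f(S)/k$ (such an element always exists), and return $(S\setminus\{r\})\cup\{x\}$. Algorithm Chasing-Local-Opt with parameter $\varepsilon$: let $N=\lceil \frac1\varepsilon\log_\phi\frac{12}{\varepsilon}\rceil$ and $S_0=\emptyset$. When $e_t$ arrives ($t=1,\dots,n$): initialize $S_t=S_{t-1}$; if $f(e_t\mid S_{t-1})\ge\frac{\phi}{k}f(S_{t-1})$, set $S_t=$ Min-Swap$(S_{t-1},e_t)$. Then repeat $N$ times: if there exists $x\in V_t$ with $f(x\mid S_t)\ge\frac{\phi}{k}f(S_t)$, choose any such $x$ and replace $S_t$ by Min-Swap$(S_t,x)$. The resulting set after these steps is the solution $S_t$. The notation $\tilde O(1/\varepsilon)$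 hides factors poly-logarithmic in $1/\varepsilon$. -}

module Defs where

open import Data.Fin as Fin using (Fin; toℕ; inject₁)
open import Data.Fin.Permutation using (Permutation′; _⟨$⟩ˡ_; _⟨$⟩ʳ_)
open import Data.Fin.Subset
  using (Subset; ⊥; ⁅_⁆; _∪_; _─_; _∈_; _∉_; _⊆_; ∣_∣)
open import Data.Integer as ℤ using (+_)
open import Data.Nat as ℕ using (ℕ; zero; suc; NonZero)
import Data.Nat.Properties as ℕ
open import Data.Product using (∃-syntax; _×_; _,_; proj₁; proj₂)
open import Data.Rational as ℚ using (ℚ; 0ℚ; 1ℚ; positive; nonNegative)
import Data.Rational.Properties as ℚ
open import Data.Rational.Solver using (module +-*-Solver)
open import Data.Vec using (tabulate)
open import Function.Bundles using (_⇔_)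
open import Relation.Binary.PropositionalEquality
open import Relation.Nullary using (¬_; does)

open +-*-Solver

-- Reals are Cauchy sequences of rationals, without quotient: equality of reals
-- is _≃_, and _≤_ is equivalent to the negation of the strict order _<_.

IsCauchy : (ℕ → ℚ) → Set
IsCauchy x = ∀ δ → 0ℚ ℚ.< δ →
  ∃[ M ] (∀ m n → M ℕ.≤ m → M ℕ.≤ n → ℚ.∣ x m ℚ.- x n ∣ ℚ.≤ δ)

record ℝ : Set where
  constructor mkℝ
  field
    seq    : ℕ → ℚ
    cauchy : IsCauchy seq

open ℝ public

infix 4 _≤_ _<_ _≥_ _≃_

_≤_ : ℝ → ℝ → Set
x ≤ y = ∀ δ → 0ℚ ℚ.< δ → ∃[ M ] (∀ n → M ℕ.≤ n → seq x n ℚ.≤ seq y n ℚ.+ δ)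

_<_ : ℝ → ℝ → Set
x < y = ∃[ δ ] (0ℚ ℚ.< δ ×
  ∃[ M ] (∀ n → M ℕ.≤ n → seq x n ℚ.+ δ ℚ.≤ seq y n))

_≥_ : ℝ → ℝ → Set
x ≥ y = y ≤ x

_≃_ : ℝ → ℝ → Set
x ≃ y = x ≤ y × y ≤ x

module CauchyLemmas where

  half : ∀ δ → 0ℚ ℚ.< δ → 0ℚ ℚ.< ℚ.½ ℚ.* δ
  half δ 0<δ = ℚ.positive⁻¹ _ {{ℚ.pos*pos⇒pos ℚ.½ δ {{positive 0<δ}}}}

  half+half : ∀ δ → ℚ.½ ℚ.* δ ℚ.+ ℚ.½ ℚ.* δ ≡ δ
  half+half δ =
    trans (sym (ℚ.*-distribʳ-+ δ ℚ.½ ℚ.½)) (ℚ.*-identityˡ δ)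

  +-cauchy : ∀ x y → IsCauchy x → IsCauchy y → IsCauchy (λ n → x n ℚ.+ y n)
  +-cauchy x y cx cy δ 0<δ
    with M₁ , h₁ ← cx _ (half δ 0<δ) | M₂ , h₂ ← cy _ (half δ 0<δ) =
    M₁ ℕ.⊔ M₂ , λ m n M≤m M≤n →
      let open ℚ.≤-Reasoning in begin
      ℚ.∣ (x m ℚ.+ y m) ℚ.- (x n ℚ.+ y n) ∣
        ≡⟨ cong ℚ.∣_∣ (solve 4 (λ a b c d →
             (a :+ b) :- (c :+ d) := (a :- c) :+ (b :- d)) refl
             (x m) (y m) (x n) (y n)) ⟩
      ℚ.∣ (x m ℚ.- x n) ℚ.+ (y m ℚ.- y n) ∣
        ≤⟨ ℚ.∣p+q∣≤∣p∣+∣q∣ (x m ℚ.- x n) (y m ℚ.- y n) ⟩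
      ℚ.∣ x m ℚ.- x n ∣ ℚ.+ ℚ.∣ y m ℚ.- y n ∣
        ≤⟨ ℚ.+-mono-≤
             (h₁ m n (ℕ.m⊔n≤o⇒m≤o M₁ M₂ M≤m) (ℕ.m⊔n≤o⇒m≤o M₁ M₂ M≤n))
             (h₂ m n (ℕ.m⊔n≤o⇒n≤o M₁ M₂ M≤m) (ℕ.m⊔n≤o⇒n≤o M₁ M₂ M≤n)) ⟩
      ℚ.½ ℚ.* δ ℚ.+ ℚ.½ ℚ.* δ
        ≡⟨ half+half δ ⟩
      δ ∎

  neg-cauchy : ∀ x → IsCauchy x → IsCauchy (λ n → ℚ.- x n)
  neg-cauchy x cx δ 0<δ with M , h ← cx δ 0<δ =
    M , λ m n M≤m M≤n → subst (ℚ._≤ δ)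
      (trans (sym (ℚ.∣-p∣≡∣p∣ (x m ℚ.- x n)))
        (cong ℚ.∣_∣ (solve 2 (λ a b → :- (a :- b) := (:- a) :- (:- b)) refl
          (x m) (x n))))
      (h m n M≤m M≤n)

  Bounded : (ℕ → ℚ) → Set
  Bounded x = ∃[ B ] (0ℚ ℚ.< B × ∃[ M ] (∀ n → M ℕ.≤ n → ℚ.∣ x n ∣ ℚ.≤ B))

  0<1 : 0ℚ ℚ.< 1ℚ
  0<1 = ℚ.positive⁻¹ 1ℚ

  bounded : ∀ {x} → IsCauchy x → Bounded x
  bounded {x} cx with M , h ← cx 1ℚ 0<1 =
    1ℚ ℚ.+ ℚ.∣ x M ∣
    , ℚ.<-≤-trans 0<1 (subst (ℚ._≤ 1ℚ ℚ.+ ℚ.∣ x M ∣) (ℚ.+-identityʳ 1ℚ)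
        (ℚ.+-mono-≤ (ℚ.≤-refl {1ℚ}) (ℚ.0≤∣p∣ (x M))))
    , M
    , λ n M≤n → let open ℚ.≤-Reasoning in begin
      ℚ.∣ x n ∣
        ≡⟨ cong ℚ.∣_∣ (solve 2 (λ a b → a := (a :- b) :+ b) refl (x n) (x M)) ⟩
      ℚ.∣ (x n ℚ.- x M) ℚ.+ x M ∣
        ≤⟨ ℚ.∣p+q∣≤∣p∣+∣q∣ (x n ℚ.- x M) (x M) ⟩
      ℚ.∣ x n ℚ.- x M ∣ ℚ.+ ℚ.∣ x M ∣
        ≤⟨ ℚ.+-mono-≤ (h n M M≤n ℕ.≤-refl) (ℚ.≤-refl {ℚ.∣ x M ∣}) ⟩
      1ℚ ℚ.+ ℚ.∣ x M ∣ ∎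

  *-mono-∣∣ : ∀ {p q r s} → 0ℚ ℚ.≤ r → 0ℚ ℚ.≤ q →
              p ℚ.≤ q → r ℚ.≤ s → p ℚ.* r ℚ.≤ q ℚ.* s
  *-mono-∣∣ {p} {q} {r} {s} 0≤r 0≤q p≤q r≤s = ℚ.≤-trans
    (ℚ.*-monoʳ-≤-nonNeg r {{nonNegative 0≤r}} p≤q)
    (ℚ.*-monoˡ-≤-nonNeg q {{nonNegative 0≤q}} r≤s)

  1/-pos : ∀ p → 0ℚ ℚ.< p → ∃[ q ] (0ℚ ℚ.< q × p ℚ.* q ≡ 1ℚ)
  1/-pos p 0<p = _ , ℚ.positive⁻¹ _ {{ℚ.1/pos⇒pos p {{pos}}}}
                   , ℚ.*-inverseʳ p {{ℚ.pos⇒nonZero p {{pos}}}}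
    where pos = positive 0<p

  0<* : ∀ {p q} → 0ℚ ℚ.< p → 0ℚ ℚ.< q → 0ℚ ℚ.< p ℚ.* q
  0<* {p} {q} 0<p 0<q =
    ℚ.positive⁻¹ _ {{ℚ.pos*pos⇒pos p {{positive 0<p}} q {{positive 0<q}}}}

  *-difference : ∀ a b c d →
    a ℚ.* b ℚ.- c ℚ.* d ≡ a ℚ.* (b ℚ.- d) ℚ.+ d ℚ.* (a ℚ.- c)
  *-difference = solve 4 (λ a b c d →
    a :* b :- c :* d := a :* (b :- d) :+ d :* (a :- c)) refl

  *-bound : ∀ a b c d {B C η} → 0ℚ ℚ.≤ B → 0ℚ ℚ.≤ C →
    ℚ.∣ a ∣ ℚ.≤ B → ℚ.∣ d ∣ ℚ.≤ C →
    ℚ.∣ a ℚ.- c ∣ ℚ.≤ η → ℚ.∣ b ℚ.- d ∣ ℚ.≤ η →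
    ℚ.∣ a ℚ.* b ℚ.- c ℚ.* d ∣ ℚ.≤ (B ℚ.+ C) ℚ.* η
  *-bound a b c d {B} {C} {η} 0≤B 0≤C a≤B d≤C ac≤η bd≤η = begin
    ℚ.∣ a ℚ.* b ℚ.- c ℚ.* d ∣
      ≡⟨ cong ℚ.∣_∣ (*-difference a b c d) ⟩
    ℚ.∣ a ℚ.* (b ℚ.- d) ℚ.+ d ℚ.* (a ℚ.- c) ∣
      ≤⟨ ℚ.∣p+q∣≤∣p∣+∣q∣ (a ℚ.* (b ℚ.- d)) (d ℚ.* (a ℚ.- c)) ⟩
    ℚ.∣ a ℚ.* (b ℚ.- d) ∣ ℚ.+ ℚ.∣ d ℚ.* (a ℚ.- c) ∣
      ≡⟨ cong₂ ℚ._+_ (ℚ.∣p*q∣≡∣p∣*∣q∣ a (b ℚ.- d))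
                     (ℚ.∣p*q∣≡∣p∣*∣q∣ d (a ℚ.- c)) ⟩
    ℚ.∣ a ∣ ℚ.* ℚ.∣ b ℚ.- d ∣ ℚ.+ ℚ.∣ d ∣ ℚ.* ℚ.∣ a ℚ.- c ∣
      ≤⟨ ℚ.+-mono-≤ (*-mono-∣∣ (ℚ.0≤∣p∣ (b ℚ.- d)) 0≤B a≤B bd≤η)
                    (*-mono-∣∣ (ℚ.0≤∣p∣ (a ℚ.- c)) 0≤C d≤C ac≤η) ⟩
    B ℚ.* η ℚ.+ C ℚ.* η
      ≡⟨ sym (ℚ.*-distribʳ-+ η B C) ⟩
    (B ℚ.+ C) ℚ.* η ∎
    where open ℚ.≤-Reasoning

  *-cauchy : ∀ x y → IsCauchy x → IsCauchy y → IsCauchy (λ n → x n ℚ.* y n)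
  *-cauchy x y cx cy δ 0<δ =
    combine (bounded cx) (bounded cy)
    where
    combine : Bounded x → Bounded y →
      ∃[ M ] (∀ m n → M ℕ.≤ m → M ℕ.≤ n →
        ℚ.∣ x m ℚ.* y m ℚ.- x n ℚ.* y n ∣ ℚ.≤ δ)
    combine (B , 0<B , K , hB) (C , 0<C , L , hC) =
      scale (1/-pos (B ℚ.+ C) (ℚ.+-mono-< 0<B 0<C))
      where
      scale : ∃[ s ] (0ℚ ℚ.< s × (B ℚ.+ C) ℚ.* s ≡ 1ℚ) →
        ∃[ M ] (∀ m n → M ℕ.≤ m → M ℕ.≤ n →
          ℚ.∣ x m ℚ.* y m ℚ.- x n ℚ.* y n ∣ ℚ.≤ δ)
      scale (s , 0<s , inverse) =
        (K ℕ.⊔ L) ℕ.⊔ (M₁ ℕ.⊔ M₂) , λ m n R≤m R≤n →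
          ℚ.≤-trans
            (*-bound (x m) (y m) (x n) (y n) (ℚ.<⇒≤ 0<B) (ℚ.<⇒≤ 0<C)
              (hB m (ℕ.m⊔n≤o⇒m≤o K L (left R≤m)))
              (hC n (ℕ.m⊔n≤o⇒n≤o K L (left R≤n)))
              (proj₂ X m n (ℕ.m⊔n≤o⇒m≤o M₁ M₂ (right R≤m))
                           (ℕ.m⊔n≤o⇒m≤o M₁ M₂ (right R≤n)))
              (proj₂ Y m n (ℕ.m⊔n≤o⇒n≤o M₁ M₂ (right R≤m))
                           (ℕ.m⊔n≤o⇒n≤o M₁ M₂ (right R≤n))))
            (ℚ.≤-reflexive cancel)
        where
        X = cx (s ℚ.* δ) (0<* 0<s 0<δ)
        Y = cy (s ℚ.* δ) (0<* 0<s 0<δ)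
        M₁ = proj₁ X
        M₂ = proj₁ Y

        left : ∀ {i} → (K ℕ.⊔ L) ℕ.⊔ (M₁ ℕ.⊔ M₂) ℕ.≤ i → K ℕ.⊔ L ℕ.≤ i
        left = ℕ.m⊔n≤o⇒m≤o (K ℕ.⊔ L) (M₁ ℕ.⊔ M₂)

        right : ∀ {i} → (K ℕ.⊔ L) ℕ.⊔ (M₁ ℕ.⊔ M₂) ℕ.≤ i → M₁ ℕ.⊔ M₂ ℕ.≤ i
        right = ℕ.m⊔n≤o⇒n≤o (K ℕ.⊔ L) (M₁ ℕ.⊔ M₂)

        cancel : (B ℚ.+ C) ℚ.* (s ℚ.* δ) ≡ δ
        cancel = trans (sym (ℚ.*-assoc (B ℚ.+ C) s δ))
          (trans (cong (ℚ._* δ) inverse) (ℚ.*-identityˡ δ))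

  1/-difference : ∀ p q u v → p ℚ.* u ≡ 1ℚ → q ℚ.* v ≡ 1ℚ →
    u ℚ.- v ≡ (q ℚ.- p) ℚ.* (u ℚ.* v)
  1/-difference p q u v pu qv = begin
    u ℚ.- v
      ≡⟨ sym (cong₂ ℚ._-_ (ℚ.*-identityʳ u) (ℚ.*-identityʳ v)) ⟩
    u ℚ.* 1ℚ ℚ.- v ℚ.* 1ℚ
      ≡⟨ sym (cong₂ (λ r s → u ℚ.* r ℚ.- v ℚ.* s) qv pu) ⟩
    u ℚ.* (q ℚ.* v) ℚ.- v ℚ.* (p ℚ.* u)
      ≡⟨ rearrange u v p q ⟩
    (q ℚ.- p) ℚ.* (u ℚ.* v) ∎
    where
    open ≡-Reasoning
    rearrange : ∀ u v p q →
      u ℚ.* (q ℚ.* v) ℚ.- v ℚ.* (p ℚ.* u) ≡ (q ℚ.- p) ℚ.* (u ℚ.* v)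
    rearrange = solve 4 (λ u v p q →
      u :* (q :* v) :- v :* (p :* u) := (q :- p) :* (u :* v)) refl

  1/-bound : ∀ {δ t} p q u v γ → 0ℚ ℚ.< t → δ ℚ.* t ≡ 1ℚ →
    0ℚ ℚ.≤ u → 0ℚ ℚ.≤ v → δ ℚ.≤ p → δ ℚ.≤ q →
    p ℚ.* u ≡ 1ℚ → q ℚ.* v ≡ 1ℚ →
    0ℚ ℚ.≤ γ → ℚ.∣ q ℚ.- p ∣ ℚ.≤ γ → ℚ.∣ u ℚ.- v ∣ ℚ.≤ γ ℚ.* (t ℚ.* t)
  1/-bound {δ} {t} p q u v γ 0<t δt 0≤u 0≤v δ≤p δ≤q pu qv 0≤γ qp≤γ = begin
    ℚ.∣ u ℚ.- v ∣
      ≡⟨ cong ℚ.∣_∣ (1/-difference p q u v pu qv) ⟩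
    ℚ.∣ (q ℚ.- p) ℚ.* (u ℚ.* v) ∣
      ≡⟨ ℚ.∣p*q∣≡∣p∣*∣q∣ (q ℚ.- p) (u ℚ.* v) ⟩
    ℚ.∣ q ℚ.- p ∣ ℚ.* ℚ.∣ u ℚ.* v ∣
      ≡⟨ cong (ℚ.∣ q ℚ.- p ∣ ℚ.*_) (trans (ℚ.∣p*q∣≡∣p∣*∣q∣ u v)
           (cong₂ ℚ._*_ (ℚ.0≤p⇒∣p∣≡p 0≤u) (ℚ.0≤p⇒∣p∣≡p 0≤v))) ⟩
    ℚ.∣ q ℚ.- p ∣ ℚ.* (u ℚ.* v)
      ≤⟨ *-mono-∣∣ 0≤uv 0≤γ qp≤γ
           (*-mono-∣∣ 0≤v (ℚ.<⇒≤ 0<t) (below p u 0≤u δ≤p pu)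
                                      (below q v 0≤v δ≤q qv)) ⟩
    γ ℚ.* (t ℚ.* t) ∎
    where
    open ℚ.≤-Reasoning

    0≤uv : 0ℚ ℚ.≤ u ℚ.* v
    0≤uv = subst (ℚ._≤ u ℚ.* v) (ℚ.*-zeroʳ u)
      (ℚ.*-monoˡ-≤-nonNeg u {{nonNegative 0≤u}} 0≤v)

    below : ∀ r w → 0ℚ ℚ.≤ w → δ ℚ.≤ r → r ℚ.* w ≡ 1ℚ → w ℚ.≤ t
    below r w 0≤w δ≤r rw = begin
      w                ≡⟨ sym (ℚ.*-identityʳ w) ⟩
      w ℚ.* 1ℚ         ≡⟨ cong (w ℚ.*_) (sym δt) ⟩
      w ℚ.* (δ ℚ.* t)  ≡⟨ sym (ℚ.*-assoc w δ t) ⟩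
      w ℚ.* δ ℚ.* t    ≤⟨ ℚ.*-monoʳ-≤-nonNeg t {{nonNegative (ℚ.<⇒≤ 0<t)}}
                           (ℚ.*-monoˡ-≤-nonNeg w {{nonNegative 0≤w}} δ≤r) ⟩
      w ℚ.* r ℚ.* t    ≡⟨ cong (ℚ._* t) (trans (ℚ.*-comm w r) rw) ⟩
      1ℚ ℚ.* t         ≡⟨ ℚ.*-identityˡ t ⟩
      t ∎

open CauchyLemmas

fromℚ : ℚ → ℝ
fromℚ q = mkℝ (λ _ → q) λ δ 0<δ →
  0 , λ _ _ _ _ → subst (ℚ._≤ δ) (cong ℚ.∣_∣ (sym (ℚ.+-inverseʳ q))) (ℚ.<⇒≤ 0<δ)

fromℕ : ℕ → ℝ
fromℕ n = fromℚ (+ n ℚ./ 1)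

0ℝ 1ℝ : ℝ
0ℝ = fromℚ 0ℚ
1ℝ = fromℚ 1ℚ

infixl 6 _+_ _-_
infixl 7 _*_
infixr 8 _^_

_+_ : ℝ → ℝ → ℝ
x + y = mkℝ (λ n → seq x n ℚ.+ seq y n)
  (+-cauchy (seq x) (seq y) (cauchy x) (cauchy y))

_-_ : ℝ → ℝ → ℝ
x - y = mkℝ (λ n → seq x n ℚ.- seq y n)
  (+-cauchy (seq x) (λ n → ℚ.- seq y n) (cauchy x) (neg-cauchy (seq y) (cauchy y)))

_*_ : ℝ → ℝ → ℝ
x * y = mkℝ (λ n → seq x n ℚ.* seq y n)
  (*-cauchy (seq x) (seq y) (cauchy x) (cauchy y))

_^_ : ℝ → ℕ → ℝ
x ^ zero  = 1ℝ
x ^ suc n = x * x ^ n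

recip : (n : ℕ) .{{_ : NonZero n}} → ℝ
recip n = fromℚ (+ 1 ℚ./ n)

-- A positive real exceeds some rational δ > 0 from some index M on, so its
-- inverse is obtained by inverting termwise the sequence shifted by M.
module _ (x : ℝ) (0<x : 0ℝ < x) where
  private
    δ = proj₁ 0<x
    0<δ = proj₁ (proj₂ 0<x)
    M = proj₁ (proj₂ (proj₂ 0<x))

    a : ℕ → ℚ
    a n = seq x (M ℕ.+ n)

    δ≤a : ∀ n → δ ℚ.≤ a n
    δ≤a n = subst (ℚ._≤ a n) (ℚ.+-identityˡ δ)
      (proj₂ (proj₂ (proj₂ 0<x)) (M ℕ.+ n) (ℕ.m≤m+n M n))

    1/a : ∀ n → ∃[ q ] (0ℚ ℚ.< q × a n ℚ.* q ≡ 1ℚ)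
    1/a n = 1/-pos (a n) (ℚ.<-≤-trans 0<δ (δ≤a n))

    1/a-cauchy : IsCauchy (λ n → proj₁ (1/a n))
    1/a-cauchy γ 0<γ = scale (1/-pos δ 0<δ)
      where
      γδ² = γ ℚ.* (δ ℚ.* δ)

      0<γδ² : 0ℚ ℚ.< γδ²
      0<γδ² = 0<* 0<γ (0<* 0<δ 0<δ)

      rearrange : ∀ g d u → g ℚ.* (d ℚ.* d) ℚ.* (u ℚ.* u) ≡
                            g ℚ.* ((d ℚ.* u) ℚ.* (d ℚ.* u))
      rearrange = solve 3 (λ g d u →
        g :* (d :* d) :* (u :* u) := g :* ((d :* u) :* (d :* u))) refl

      scale : ∃[ t ] (0ℚ ℚ.< t × δ ℚ.* t ≡ 1ℚ) →
        ∃[ K ] (∀ m n → K ℕ.≤ m → K ℕ.≤ n →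
          ℚ.∣ proj₁ (1/a m) ℚ.- proj₁ (1/a n) ∣ ℚ.≤ γ)
      scale (t , 0<t , δt) = proj₁ X , λ m n K≤m K≤n →
        ℚ.≤-trans
          (1/-bound (a m) (a n) (proj₁ (1/a m)) (proj₁ (1/a n)) γδ² 0<t δt
            (ℚ.<⇒≤ (proj₁ (proj₂ (1/a m)))) (ℚ.<⇒≤ (proj₁ (proj₂ (1/a n))))
            (δ≤a m) (δ≤a n) (proj₂ (proj₂ (1/a m))) (proj₂ (proj₂ (1/a n)))
            (ℚ.<⇒≤ 0<γδ²)
            (proj₂ X (M ℕ.+ n) (M ℕ.+ m)
              (ℕ.≤-trans K≤n (ℕ.m≤n+m n M)) (ℕ.≤-trans K≤m (ℕ.m≤n+m m M))))
          (ℚ.≤-reflexive cancel)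
        where
        X = cauchy x γδ² 0<γδ²

        cancel : γδ² ℚ.* (t ℚ.* t) ≡ γ
        cancel = trans (rearrange γ δ t)
          (trans (cong (λ r → γ ℚ.* (r ℚ.* r)) δt) (ℚ.*-identityʳ γ))

  inv : ℝ
  inv = mkℝ (λ n → proj₁ (1/a n)) 1/a-cauchy

IsSqrt : ℝ → ℝ → Set
IsSqrt x s = 0ℝ ≤ s × s * s ≃ x

-- The number e is the only real with (1+1/n)^n ≤ e ≤ (1+1/n)^(n+1) for all n ≥ 1.
IsEuler : ℝ → Set
IsEuler e = ∀ n .{{_ : NonZero n}} →
  (1ℝ + recip n) ^ n ≤ e × e ≤ (1ℝ + recip n) ^ suc n

-- L = log_b y, for b > 1 and y > 0: a rational (p - r)/q is at most L exactly
-- when b^((p - r)/q) ≤ y.  Denominators are cleared so that only natural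
-- exponents occur.
IsLog : ℝ → ℝ → ℝ → Set
IsLog b y L = ∀ p r q .{{_ : NonZero q}} →
  (b ^ p ≤ b ^ r * y ^ q) ⇔ (fromℕ p ≤ fromℕ r + fromℕ q * L)

-- N = ⌈x⌉, for x > -1.
IsCeil : ℝ → ℕ → Set
IsCeil x N = x ≤ fromℕ N × fromℕ N < x + 1ℝ

golden : ℝ → ℝ
golden √5 = (1ℝ + √5) * recip 2

marginal : ∀ {n} → (Subset n → ℝ) → Subset n → Subset n → ℝ
marginal f X Y = f (X ∪ Y) - f Y

record MonotoneNormalizedSubmodular {n} (f : Subset n → ℝ) : Set where
  field
    nonneg     : ∀ X → 0ℝ ≤ f X
    monotone   : ∀ X e → marginal f ⁅ e ⁆ X ≥ 0ℝ
    normalized : f ⊥ ≃ 0ℝ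
    submodular : ∀ {X Y e} → X ⊆ Y → e ∉ Y →
                 marginal f ⁅ e ⁆ X ≥ marginal f ⁅ e ⁆ Y

-- An ordering e₁,…,eₙ of V is a permutation π with e_{i+1} = π ⟨$⟩ʳ i, so the
-- arrival index of x (counted from 0) is π ⟨$⟩ˡ x; prefix π t is V_t.
prefix : ∀ {n} → Permutation′ n → ℕ → Subset n
prefix π t = tabulate λ x → does (toℕ (π ⟨$⟩ˡ x) ℕ.<? t)

IsOPT : ∀ {n} → (Subset n → ℝ) → ℕ → Subset n → Subset n → Set
IsOPT f k V O =
  O ⊆ V × ∣ O ∣ ℕ.≤ k × (∀ T → T ⊆ V → ∣ T ∣ ℕ.≤ k → f T ≤ f O)

-- The ground set V is Fin n.  The algorithm's arbitrary choices make every step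
-- a relation between the set before and the set after.

module Algorithm {n} (φ : ℝ) (k : ℕ) .{{_ : NonZero k}}
                 (f : Subset n → ℝ) (N : ℕ) (π : Permutation′ n) where

  Improves : Fin n → Subset n → Set
  Improves x S = marginal f ⁅ x ⁆ S ≥ φ * recip k * f S

  data MinSwap (S : Subset n) (x : Fin n) : Subset n → Set where
    insert   : ∣ S ∣ ℕ.< k → MinSwap S x (S ∪ ⁅ x ⁆)
    exchange : ∀ r → ¬ ∣ S ∣ ℕ.< k → r ∈ S →
               marginal f ⁅ r ⁆ (S ─ ⁅ r ⁆) ≤ f S * recip k →
               MinSwap S x ((S ─ ⁅ r ⁆) ∪ ⁅ x ⁆)

  data Arrival (x : Fin n) (S : Subset n) : Subset n → Set where
    accept : ∀ {S′} → Improves x S → MinSwap S x S′ → Arrival x S S′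
    reject : ¬ Improves x S → Arrival x S S

  data LocalStep (V : Subset n) (S : Subset n) : Subset n → Set where
    swap : ∀ {S′} x → x ∈ V → Improves x S → MinSwap S x S′ → LocalStep V S S′
    stay : ¬ (∃[ x ] (x ∈ V × Improves x S)) → LocalStep V S S

  data LocalSteps (V : Subset n) : ℕ → Subset n → Subset n → Set where
    done : ∀ {S} → LocalSteps V zero S S
    step : ∀ {m S S′ S″} →
           LocalStep V S S′ → LocalSteps V m S′ S″ → LocalSteps V (suc m) S S″

  -- S t is the solution S_t, for t = 0,…,n.
  record IsRun (S : Fin (suc n) → Subset n) : Set where
    field
      start : S Fin.zero ≡ ⊥
      round : ∀ (i : Fin n) → ∃[ S′ ]
        ( Arrival (π ⟨$⟩ʳ i) (S (inject₁ i)) S′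
        × LocalSteps (prefix π (suc (toℕ i))) N S′ (S (Fin.suc i)) )

module Submission where

-- Let T contain the current solution S and every element that S has held since
-- the last local optimum.  A swap inserting x raises f(S) by at least
-- f(x | S) − f(S)/k ≥ (1 − 1/φ) f(x | S) = f(x | S)/φ², so by submodularity
-- f(O ∪ T) grows by at most φ² times what f(S) gains.  At a local optimum
-- f(O ∪ S) ≤ f(S) + k (φ/k) f(S) = φ² f(S) for |O| ≤ k.  Hence the bound
-- f(O ∪ T) ≤ φ² f(S) + b survives every swap, is restored with b = 0 at a local
-- optimum, and a rejected arrival adds only (φ/k) f(S) to b.  A round that does
-- not end in a local optimum performs N swaps and so multiplies f(S) by at
-- least 1 + N (φ − 1)/k; as N ε ≥ 1, the bound b = 9 ε f(S) grows by enough to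
-- absorb one rejection.
--
-- The solution changes by at most N + 1 elements per round.  From e ≤ 4 ≤ φ³
-- and 12 ≤ 2⁴ ≤ e⁴ it follows that log_φ(12/ε) ≤ 12 (1 + ln(1/ε)), which gives
-- N + 1 ≤ (14/ε) (1 + ln(1/ε)).

open import Defs
open import Data.Fin as Fin using (Fin; toℕ; inject₁)
open import Data.Fin.Induction using (<-weakInduction)
open import Data.Fin.Permutation
  using (Permutation′; _⟨$⟩ˡ_; _⟨$⟩ʳ_; inverseʳ)
import Data.Fin.Properties as Fin
open import Data.Fin.Subset
  using (Subset; ⊥; ⁅_⁆; _∪_; _─_; _∈_; _∉_; _⊆_; ∣_∣; inside; outside)
open import Data.Fin.Subset.Properties
open import Data.Bool using (true)
open import Data.Integer as ℤ using (+_; -[1+_])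
import Data.Integer.Properties as ℤ
open import Data.Nat as ℕ using (ℕ; zero; suc; NonZero; z≤n; s≤s)
import Data.Nat.Properties as ℕ
open import Data.Product using (∃-syntax; _×_; _,_; proj₁; proj₂)
open import Data.Rational as ℚ using (ℚ; mkℚ; 0ℚ; 1ℚ; nonNegative)
import Data.Rational.Properties as ℚ
open import Data.Rational.Solver using (module +-*-Solver)
open import Data.Rational.Unnormalised as ℚᵘ using (mkℚᵘ)
import Data.Rational.Unnormalised.Properties as ℚᵘ
open import Data.Sum using (_⊎_; inj₁; inj₂; [_,_]′)
open import Data.Vec using ([]; _∷_; here; there)
open import Data.Vec.Properties using ([]=⇒lookup; lookup⇒[]=; lookup∘tabulate)
open import Function.Bundles using (Equivalence)
open import Relation.Binary.PropositionalEquality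
open import Relation.Nullary using (¬_; Dec; yes; no; does; contradiction)
open import Relation.Nullary.Decidable using (dec-true)

open CauchyLemmas
open +-*-Solver

-- Order and arithmetic of the reals

p≤p+q : ∀ {q} p → 0ℚ ℚ.≤ q → p ℚ.≤ p ℚ.+ q
p≤p+q {q} p 0≤q =
  subst (ℚ._≤ p ℚ.+ q) (ℚ.+-identityʳ p) (ℚ.+-monoʳ-≤ p 0≤q)

0≤p*q : ∀ {p q} → 0ℚ ℚ.≤ p → 0ℚ ℚ.≤ q → 0ℚ ℚ.≤ p ℚ.* q
0≤p*q {p} {q} 0≤p 0≤q = subst (ℚ._≤ p ℚ.* q) (ℚ.*-zeroʳ p)
  (ℚ.*-monoˡ-≤-nonNeg p {{nonNegative 0≤p}} 0≤q)

p≤∣p∣ : ∀ p → p ℚ.≤ ℚ.∣ p ∣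
p≤∣p∣ p with ℚ.≤-total 0ℚ p
... | inj₁ 0≤p = ℚ.≤-reflexive (sym (ℚ.0≤p⇒∣p∣≡p 0≤p))
... | inj₂ p≤0 = ℚ.≤-trans p≤0 (ℚ.0≤∣p∣ p)

∣p-q∣≤r⇒p≤q+r : ∀ p q {r} → ℚ.∣ p ℚ.- q ∣ ℚ.≤ r → p ℚ.≤ q ℚ.+ r
∣p-q∣≤r⇒p≤q+r p q {r} h = begin
  p                  ≡⟨ solve 2 (λ p q → p := q :+ (p :- q)) refl p q ⟩
  q ℚ.+ (p ℚ.- q)    ≤⟨ ℚ.+-monoʳ-≤ q (ℚ.≤-trans (p≤∣p∣ (p ℚ.- q)) h) ⟩
  q ℚ.+ r            ∎
  where open ℚ.≤-Reasoning

-- Indexed by sequences rather than reals, because conversion checking would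
-- otherwise have to compare Cauchy proofs.
record Nonneg (u : ℕ → ℚ) : Set where
  constructor nonneg
  field
    isCauchy : IsCauchy u
    0≤       : 0ℝ ≤ mkℝ u isCauchy

infixl 6 _⊕_
infixl 7 _⊗_

-- Inequalities are proved by certificates: y − x is exhibited as a polynomial w
-- with nonnegative coefficients in known nonnegative quantities, and the ring
-- solver over ℚ checks y ≡ x + w at every index.
≤-by : ∀ {w} x y → Nonneg w →
       (∀ n → seq y n ≡ seq x n ℚ.+ w n) → x ≤ y
≤-by {w} x y (nonneg _ 0≤w) y≡x+w δ 0<δ with M , h ← 0≤w δ 0<δ =
  M , λ n M≤n → let open ℚ.≤-Reasoning in begin
    seq x n                    ≤⟨ p≤p+q (seq x n) (h n M≤n) ⟩
    seq x n ℚ.+ (w n ℚ.+ δ)    ≡⟨ ℚ.+-assoc (seq x n) (w n) δ ⟨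
    seq x n ℚ.+ w n ℚ.+ δ      ≡⟨ cong (ℚ._+ δ) (y≡x+w n) ⟨
    seq y n ℚ.+ δ              ∎

0≤⇒nonneg : ∀ x → 0ℝ ≤ x → Nonneg (seq x)
0≤⇒nonneg x 0≤x = nonneg (cauchy x) 0≤x

-- Lets termwise identities act as inequalities although the two reals carry different Cauchy
-- proofs.
≐⇒≤ : ∀ x y → (∀ n → seq x n ≡ seq y n) → x ≤ y
≐⇒≤ x y x≡y δ 0<δ = 0 , λ n _ →
  subst (ℚ._≤ seq y n ℚ.+ δ) (sym (x≡y n)) (p≤p+q (seq y n) (ℚ.<⇒≤ 0<δ))

-- Turns a known inequality into a building block of certificates; `_⊕_` and `_⊗_` combine such
-- blocks.
diff : ∀ x y → x ≤ y → Nonneg (λ n → seq y n ℚ.- seq x n)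
diff x y x≤y = nonneg (cauchy (y - x)) λ δ 0<δ →
  let M , h = x≤y δ 0<δ in M , λ n M≤n → let open ℚ.≤-Reasoning in begin
    0ℚ                             ≡⟨ ℚ.+-inverseʳ (seq x n) ⟨
    seq x n ℚ.- seq x n            ≤⟨ ℚ.+-monoˡ-≤ (ℚ.- seq x n) (h n M≤n) ⟩
    seq y n ℚ.+ δ ℚ.- seq x n      ≡⟨ solve 3 (λ x y δ →
                                        y :+ δ :- x := y :- x :+ δ) refl
                                        (seq x n) (seq y n) δ ⟩
    seq y n ℚ.- seq x n ℚ.+ δ      ∎

_⊕_ : ∀ {x y} → Nonneg x → Nonneg y → Nonneg (λ n → x n ℚ.+ y n)
_⊕_ {x} {y} (nonneg cx 0≤x) (nonneg cy 0≤y) = nonneg (+-cauchy x y cx cy) λ δ 0<δ →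
  let M₁ , h₁ = 0≤x _ (half δ 0<δ)
      M₂ , h₂ = 0≤y _ (half δ 0<δ)
  in M₁ ℕ.⊔ M₂ , λ n M≤n → let open ℚ.≤-Reasoning in begin
    0ℚ
      ≤⟨ ℚ.+-mono-≤ (h₁ n (ℕ.m⊔n≤o⇒m≤o M₁ M₂ M≤n))
                    (h₂ n (ℕ.m⊔n≤o⇒n≤o M₁ M₂ M≤n)) ⟩
    x n ℚ.+ ℚ.½ ℚ.* δ ℚ.+ (y n ℚ.+ ℚ.½ ℚ.* δ)
      ≡⟨ solve 3 (λ x y d → x :+ d :+ (y :+ d) := x :+ y :+ (d :+ d)) refl
           (x n) (y n) (ℚ.½ ℚ.* δ) ⟩
    x n ℚ.+ y n ℚ.+ (ℚ.½ ℚ.* δ ℚ.+ ℚ.½ ℚ.* δ)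
      ≡⟨ cong (x n ℚ.+ y n ℚ.+_) (half+half δ) ⟩
    x n ℚ.+ y n ℚ.+ δ ∎

private
  -- Both factors are nonnegative once raised by `η`. Expanding the product of the raised factors
  -- leaves the error `(u + v + η) η`, which the upper bounds keep below `δ`.
  product-bound : ∀ u v B C η δ → 0ℚ ℚ.≤ u ℚ.+ η → 0ℚ ℚ.≤ v ℚ.+ η →
    u ℚ.≤ B → v ℚ.≤ C → 0ℚ ℚ.≤ η → η ℚ.≤ 1ℚ →
    (B ℚ.+ C ℚ.+ 1ℚ) ℚ.* η ℚ.≤ δ → 0ℚ ℚ.≤ u ℚ.* v ℚ.+ δ
  product-bound u v B C η δ 0≤u+η 0≤v+η u≤B v≤C 0≤η η≤1 bound = begin
    0ℚ
      ≤⟨ 0≤p*q 0≤u+η 0≤v+η ⟩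
    (u ℚ.+ η) ℚ.* (v ℚ.+ η)
      ≡⟨ solve 3 (λ u v η → (u :+ η) :* (v :+ η) :=
           u :* v :+ (u :+ v :+ η) :* η) refl u v η ⟩
    u ℚ.* v ℚ.+ (u ℚ.+ v ℚ.+ η) ℚ.* η
      ≤⟨ ℚ.+-monoʳ-≤ (u ℚ.* v) (ℚ.*-monoʳ-≤-nonNeg η {{nonNegative 0≤η}}
           (ℚ.+-mono-≤ (ℚ.+-mono-≤ u≤B v≤C) η≤1)) ⟩
    u ℚ.* v ℚ.+ (B ℚ.+ C ℚ.+ 1ℚ) ℚ.* η
      ≤⟨ ℚ.+-monoʳ-≤ (u ℚ.* v) bound ⟩
    u ℚ.* v ℚ.+ δ ∎
    where open ℚ.≤-Reasoning

  0<⊓ : ∀ {p q} → 0ℚ ℚ.< p → 0ℚ ℚ.< q → 0ℚ ℚ.< p ℚ.⊓ q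
  0<⊓ {p} {q} 0<p 0<q with ℚ.⊓-sel p q
  ... | inj₁ eq = subst (0ℚ ℚ.<_) (sym eq) 0<p
  ... | inj₂ eq = subst (0ℚ ℚ.<_) (sym eq) 0<q

_⊗_ : ∀ {x y} → Nonneg x → Nonneg y → Nonneg (λ n → x n ℚ.* y n)
_⊗_ {x} {y} (nonneg cx 0≤x) (nonneg cy 0≤y) = nonneg (*-cauchy x y cx cy) λ δ 0<δ →
  let B , 0<B , K₁ , x≤B = bounded {x} cx
      C , 0<C , K₂ , y≤C = bounded {y} cy
      D = B ℚ.+ C ℚ.+ 1ℚ
      s , 0<s , Ds = 1/-pos D (ℚ.+-mono-< (ℚ.+-mono-< 0<B 0<C) 0<1)
      -- As `s` is the inverse of `D`, `η ≤ s δ` gives `D η ≤ δ`, while `η ≤ 1` controls the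
      -- quadratic part of the error.
      η = 1ℚ ℚ.⊓ (s ℚ.* δ)
      0<η = 0<⊓ 0<1 (0<* 0<s 0<δ)
      M₁ , h₁ = 0≤x η 0<η
      M₂ , h₂ = 0≤y η 0<η
      D*η≤δ = ℚ.≤-trans
        (ℚ.*-monoˡ-≤-nonNeg D
          {{nonNegative (ℚ.<⇒≤ (ℚ.+-mono-< (ℚ.+-mono-< 0<B 0<C) 0<1))}}
          (ℚ.p⊓q≤q 1ℚ (s ℚ.* δ)))
        (ℚ.≤-reflexive (trans (sym (ℚ.*-assoc D s δ))
          (trans (cong (ℚ._* δ) Ds) (ℚ.*-identityˡ δ))))
  in (M₁ ℕ.⊔ M₂) ℕ.⊔ (K₁ ℕ.⊔ K₂) , λ n R≤n →
     let M≤n = ℕ.m⊔n≤o⇒m≤o (M₁ ℕ.⊔ M₂) (K₁ ℕ.⊔ K₂) R≤n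
         K≤n = ℕ.m⊔n≤o⇒n≤o (M₁ ℕ.⊔ M₂) (K₁ ℕ.⊔ K₂) R≤n
     in product-bound (x n) (y n) B C η δ
          (h₁ n (ℕ.m⊔n≤o⇒m≤o M₁ M₂ M≤n)) (h₂ n (ℕ.m⊔n≤o⇒n≤o M₁ M₂ M≤n))
          (ℚ.≤-trans (p≤∣p∣ (x n)) (x≤B n (ℕ.m⊔n≤o⇒m≤o K₁ K₂ K≤n)))
          (ℚ.≤-trans (p≤∣p∣ (y n)) (y≤C n (ℕ.m⊔n≤o⇒n≤o K₁ K₂ K≤n)))
          (ℚ.<⇒≤ 0<η) (ℚ.p⊓q≤p 1ℚ (s ℚ.* δ)) D*η≤δ

fromℚ-mono : ∀ {p q} → p ℚ.≤ q → fromℚ p ≤ fromℚ q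
fromℚ-mono {p} {q} p≤q δ 0<δ =
  0 , λ _ _ → ℚ.≤-trans p≤q (p≤p+q q (ℚ.<⇒≤ 0<δ))

fromℚ-nonneg : ∀ {p} → 0ℚ ℚ.≤ p → Nonneg (λ _ → p)
fromℚ-nonneg {p} 0≤p = 0≤⇒nonneg (fromℚ p) (fromℚ-mono 0≤p)

≤-refl : ∀ x → x ≤ x
≤-refl x = ≐⇒≤ x x λ _ → refl

≤-trans : ∀ x y z → x ≤ y → y ≤ z → x ≤ z
≤-trans x y z x≤y y≤z = ≤-by x z (diff x y x≤y ⊕ diff y z y≤z)
  λ n → solve 3 (λ x y z → z := x :+ ((y :- x) :+ (z :- y))) refl
    (seq x n) (seq y n) (seq z n)

<⇒≤ : ∀ x y → x < y → x ≤ y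
<⇒≤ x y (d , 0<d , M , h) δ 0<δ = M , λ n M≤n →
  ℚ.≤-trans (p≤p+q (seq x n) (ℚ.<⇒≤ 0<d))
    (ℚ.≤-trans (h n M≤n) (p≤p+q (seq y n) (ℚ.<⇒≤ 0<δ)))

<⇒≱ : ∀ x y → x < y → ¬ y ≤ x
<⇒≱ x y (d , 0<d , M , h) y≤x with K , g ← y≤x _ (half d 0<d) =
  ℚ.<-irrefl refl (ℚ.<-≤-trans half<d d≤half)
  where
  open ℚ.≤-Reasoning
  R = M ℕ.⊔ K
  a = seq x R

  half<d : ℚ.½ ℚ.* d ℚ.< d
  half<d = subst (ℚ.½ ℚ.* d ℚ.<_) (half+half d)
    (subst (ℚ._< ℚ.½ ℚ.* d ℚ.+ ℚ.½ ℚ.* d) (ℚ.+-identityʳ (ℚ.½ ℚ.* d))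
      (ℚ.+-monoʳ-< (ℚ.½ ℚ.* d) (half d 0<d)))

  cancel : ∀ a d → ℚ.- a ℚ.+ (a ℚ.+ d) ≡ d
  cancel = solve 2 (λ a d → :- a :+ (a :+ d) := d) refl

  d≤half : d ℚ.≤ ℚ.½ ℚ.* d
  d≤half = begin
    d                                  ≡⟨ cancel a d ⟨
    ℚ.- a ℚ.+ (a ℚ.+ d)                ≤⟨ ℚ.+-monoʳ-≤ (ℚ.- a) (ℚ.≤-trans
                                            (h R (ℕ.m≤m⊔n M K))
                                            (g R (ℕ.m≤n⊔m M K))) ⟩
    ℚ.- a ℚ.+ (a ℚ.+ ℚ.½ ℚ.* d)        ≡⟨ cancel a (ℚ.½ ℚ.* d) ⟩
    ℚ.½ ℚ.* d                          ∎

≤-<-trans : ∀ x y z → x ≤ y → y < z → x < z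
≤-<-trans x y z x≤y (δ , 0<δ , M , h) =
  let K , g = x≤y _ (half δ 0<δ) in
  η , half δ 0<δ , M ℕ.⊔ K , λ n R≤n → let open ℚ.≤-Reasoning in begin
    seq x n ℚ.+ η            ≤⟨ ℚ.+-monoˡ-≤ η
                                  (g n (ℕ.m⊔n≤o⇒n≤o M K R≤n)) ⟩
    seq y n ℚ.+ η ℚ.+ η      ≡⟨ trans (ℚ.+-assoc (seq y n) η η)
                                  (cong (seq y n ℚ.+_) (half+half δ)) ⟩
    seq y n ℚ.+ δ            ≤⟨ h n (ℕ.m⊔n≤o⇒m≤o M K R≤n) ⟩
    seq z n                  ∎
  where η = ℚ.½ ℚ.* δ

-- Comparing the two sequences at one index beyond which both vary by at most
-- δ/4 decides between x < y and y ≤ x + δ.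
≮⇒≥ : ∀ x y → ¬ x < y → y ≤ x
≮⇒≥ x y x≮y δ 0<δ = compare (seq y R ℚ.≤? seq x R ℚ.+ h)
  where
  open ℚ.≤-Reasoning
  h = ℚ.½ ℚ.* δ
  0<h = half δ 0<δ
  γ = ℚ.½ ℚ.* h
  0<γ = half h 0<h
  γ+γ≡h = half+half h
  M = proj₁ (cauchy x γ 0<γ)
  K = proj₁ (cauchy y γ 0<γ)
  R = M ℕ.⊔ K

  near : ∀ z N (N≤R : N ℕ.≤ R) →
    (∀ m n → N ℕ.≤ m → N ℕ.≤ n → ℚ.∣ seq z m ℚ.- seq z n ∣ ℚ.≤ γ) →
    ∀ n → R ℕ.≤ n → seq z n ℚ.≤ seq z R ℚ.+ γ × seq z R ℚ.≤ seq z n ℚ.+ γ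
  near z N N≤R c n R≤n =
      ∣p-q∣≤r⇒p≤q+r (seq z n) (seq z R) (c n R (ℕ.≤-trans N≤R R≤n) N≤R)
    , ∣p-q∣≤r⇒p≤q+r (seq z R) (seq z n) (c R n N≤R (ℕ.≤-trans N≤R R≤n))

  near-x = near x M (ℕ.m≤m⊔n M K) (proj₂ (cauchy x γ 0<γ))
  near-y = near y K (ℕ.m≤n⊔m M K) (proj₂ (cauchy y γ 0<γ))

  compare : _ → ∃[ R ] (∀ n → R ℕ.≤ n → seq y n ℚ.≤ seq x n ℚ.+ δ)
  compare (yes y≤x+h) = R , λ n R≤n → begin
    seq y n
      ≤⟨ proj₁ (near-y n R≤n) ⟩
    seq y R ℚ.+ γ
      ≤⟨ ℚ.+-monoˡ-≤ γ y≤x+h ⟩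
    seq x R ℚ.+ h ℚ.+ γ
      ≤⟨ ℚ.+-monoˡ-≤ γ (ℚ.+-monoˡ-≤ h (proj₂ (near-x n R≤n))) ⟩
    seq x n ℚ.+ γ ℚ.+ h ℚ.+ γ
      ≡⟨ solve 3 (λ x γ h → x :+ γ :+ h :+ γ := x :+ (γ :+ γ :+ h)) refl
           (seq x n) γ h ⟩
    seq x n ℚ.+ (γ ℚ.+ γ ℚ.+ h)
      ≡⟨ cong (seq x n ℚ.+_) (trans (cong (ℚ._+ h) γ+γ≡h) (half+half δ)) ⟩
    seq x n ℚ.+ δ ∎
  compare (no y≰x+h) = contradiction (d , 0<d , R , x+d≤y) x≮y
    where
    d = seq y R ℚ.- (seq x R ℚ.+ h)
    0<d : 0ℚ ℚ.< d
    0<d = subst (ℚ._< d) (ℚ.+-inverseʳ (seq x R ℚ.+ h))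
      (ℚ.+-monoˡ-< (ℚ.- (seq x R ℚ.+ h)) (ℚ.≰⇒> y≰x+h))
    x+d≤y : ∀ n → R ℕ.≤ n → seq x n ℚ.+ d ℚ.≤ seq y n
    x+d≤y n R≤n = begin
      seq x n ℚ.+ d
        ≤⟨ ℚ.+-mono-≤ (proj₁ (near-x n R≤n))
             (ℚ.+-monoˡ-≤ (ℚ.- (seq x R ℚ.+ h)) (proj₂ (near-y n R≤n))) ⟩
      seq x R ℚ.+ γ ℚ.+ (seq y n ℚ.+ γ ℚ.- (seq x R ℚ.+ h))
        ≡⟨ cong (λ h → seq x R ℚ.+ γ ℚ.+ (seq y n ℚ.+ γ ℚ.- (seq x R ℚ.+ h)))
             (sym γ+γ≡h) ⟩
      seq x R ℚ.+ γ ℚ.+ (seq y n ℚ.+ γ ℚ.- (seq x R ℚ.+ (γ ℚ.+ γ)))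
        ≡⟨ solve 3 (λ x y γ → x :+ γ :+ (y :+ γ :- (x :+ (γ :+ γ))) := y) refl
             (seq x R) (seq y n) γ ⟩
      seq y n ∎

-- The order is not decided anywhere, but a refuted inequality still yields the reverse one. This
-- turns the failure of `Improves` into an upper bound on a marginal value.
≰⇒≥ : ∀ x y → ¬ x ≤ y → y ≤ x
≰⇒≥ x y x≰y = ≮⇒≥ x y λ x<y → x≰y (<⇒≤ x y x<y)

-- A term of the sequence of y far enough along, lowered by half the gap.
rational-between : ∀ x y → x < y → ∃[ r ] (x < fromℚ r × fromℚ r ≤ y)
rational-between x y (d , 0<d , M , h) =
  r , (γ , 0<γ , R , below) , λ δ 0<δ → R , λ n R≤n →
    ℚ.≤-trans (above n R≤n) (p≤p+q (seq y n) (ℚ.<⇒≤ 0<δ))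
  where
  open ℚ.≤-Reasoning
  η = ℚ.½ ℚ.* d
  γ = ℚ.½ ℚ.* η
  0<η = half d 0<d
  0<γ = half η 0<η
  K = proj₁ (cauchy y γ 0<γ)
  c = proj₂ (cauchy y γ 0<γ)
  R = M ℕ.⊔ K
  r = seq y R ℚ.- η
  M≤ : ∀ {n} → R ℕ.≤ n → M ℕ.≤ n
  M≤ = ℕ.≤-trans (ℕ.m≤m⊔n M K)
  K≤ : ∀ {n} → R ℕ.≤ n → K ℕ.≤ n
  K≤ = ℕ.≤-trans (ℕ.m≤n⊔m M K)

  below : ∀ n → R ℕ.≤ n → seq x n ℚ.+ γ ℚ.≤ r
  below n R≤n = begin
    seq x n ℚ.+ γ
      ≡⟨ solve 3 (λ x γ d → x :+ γ := x :+ d :+ (γ :- d)) refl (seq x n) γ d ⟩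
    seq x n ℚ.+ d ℚ.+ (γ ℚ.- d)
      ≤⟨ ℚ.+-monoˡ-≤ (γ ℚ.- d) (h n (M≤ R≤n)) ⟩
    seq y n ℚ.+ (γ ℚ.- d)
      ≤⟨ ℚ.+-monoˡ-≤ (γ ℚ.- d) (∣p-q∣≤r⇒p≤q+r (seq y n) (seq y R)
           (c n R (K≤ R≤n) (K≤ ℕ.≤-refl))) ⟩
    seq y R ℚ.+ γ ℚ.+ (γ ℚ.- d)
      ≡⟨ solve 3 (λ y γ d → y :+ γ :+ (γ :- d) := y :+ (γ :+ γ :- d)) refl
           (seq y R) γ d ⟩
    seq y R ℚ.+ (γ ℚ.+ γ ℚ.- d)
      ≡⟨ cong (λ e → seq y R ℚ.+ e) (trans (cong₂ ℚ._-_ (half+half η)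
           (sym (half+half d)))
           (solve 1 (λ e → e :- (e :+ e) := :- e) refl η)) ⟩
    r ∎

  above : ∀ n → R ℕ.≤ n → r ℚ.≤ seq y n
  above n R≤n = begin
    seq y R ℚ.- η
      ≤⟨ ℚ.+-monoˡ-≤ (ℚ.- η) (∣p-q∣≤r⇒p≤q+r (seq y R) (seq y n)
           (c R n (K≤ ℕ.≤-refl) (K≤ R≤n))) ⟩
    seq y n ℚ.+ γ ℚ.- η
      ≡⟨ cong (λ e → seq y n ℚ.+ γ ℚ.- e) (sym (half+half η)) ⟩
    seq y n ℚ.+ γ ℚ.- (γ ℚ.+ γ)
      ≡⟨ solve 2 (λ y γ → y :+ γ :- (γ :+ γ) := y :- γ) refl (seq y n) γ ⟩
    seq y n ℚ.- γ
      ≤⟨ ℚ.+-monoʳ-≤ (seq y n) (ℚ.neg-antimono-≤ (ℚ.<⇒≤ 0<γ)) ⟩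
    seq y n ℚ.+ 0ℚ
      ≡⟨ ℚ.+-identityʳ (seq y n) ⟩
    seq y n ∎

-- `inv` inverts a shifted sequence, so each term of the product differs from 1 by a term of the
-- inverse times a difference of two terms of `x`: a bounded factor times a small one.
1≤*-inv : ∀ x 0<x → 1ℝ ≤ x * inv x 0<x
1≤*-inv x 0<x@(δ , 0<δ , M , h) γ 0<γ =
  let B , 0<B , K₁ , i≤B = bounded {seq i} (cauchy i)
      s , 0<s , Bs = 1/-pos B 0<B
      K₂ , c = cauchy x (s ℚ.* γ) (0<* 0<s 0<γ)
  in K₁ ℕ.⊔ K₂ , λ n K≤n →
    let K₂≤n = ℕ.m⊔n≤o⇒n≤o K₁ K₂ K≤n in
    ∣p-q∣≤r⇒p≤q+r 1ℚ (seq x n ℚ.* seq i n) (begin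
      ℚ.∣ 1ℚ ℚ.- seq x n ℚ.* seq i n ∣
        ≡⟨ cong (λ r → ℚ.∣ r ℚ.- seq x n ℚ.* seq i n ∣) (inverse n) ⟨
      ℚ.∣ seq x (M ℕ.+ n) ℚ.* seq i n ℚ.- seq x n ℚ.* seq i n ∣
        ≡⟨ cong ℚ.∣_∣ (solve 3 (λ a b i → a :* i :- b :* i := i :* (a :- b))
             refl (seq x (M ℕ.+ n)) (seq x n) (seq i n)) ⟩
      ℚ.∣ seq i n ℚ.* (seq x (M ℕ.+ n) ℚ.- seq x n) ∣
        ≡⟨ ℚ.∣p*q∣≡∣p∣*∣q∣ (seq i n) (seq x (M ℕ.+ n) ℚ.- seq x n) ⟩
      ℚ.∣ seq i n ∣ ℚ.* ℚ.∣ seq x (M ℕ.+ n) ℚ.- seq x n ∣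
        ≤⟨ *-mono-∣∣ (ℚ.0≤∣p∣ (seq x (M ℕ.+ n) ℚ.- seq x n)) (ℚ.<⇒≤ 0<B)
             (i≤B n (ℕ.m⊔n≤o⇒m≤o K₁ K₂ K≤n))
             (c (M ℕ.+ n) n (ℕ.≤-trans K₂≤n (ℕ.m≤n+m n M)) K₂≤n) ⟩
      B ℚ.* (s ℚ.* γ)
        ≡⟨ ℚ.*-assoc B s γ ⟨
      B ℚ.* s ℚ.* γ
        ≡⟨ trans (cong (ℚ._* γ) Bs) (ℚ.*-identityˡ γ) ⟩
      γ ∎)
  where
  open ℚ.≤-Reasoning
  i = inv x 0<x

  inverse : ∀ n → seq x (M ℕ.+ n) ℚ.* seq i n ≡ 1ℚ
  inverse n = proj₂ (proj₂ (1/-pos (seq x (M ℕ.+ n)) (ℚ.<-≤-trans 0<δ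
    (subst (ℚ._≤ seq x (M ℕ.+ n)) (ℚ.+-identityˡ δ)
      (h (M ℕ.+ n) (ℕ.m≤m+n M n))))))

0≤inv : ∀ x 0<x → 0ℝ ≤ inv x 0<x
0≤inv x (δ , 0<δ , M , h) γ 0<γ = 0 , λ n _ → ℚ.≤-trans
  (ℚ.<⇒≤ (proj₁ (proj₂ (1/-pos (seq x (M ℕ.+ n)) (ℚ.<-≤-trans 0<δ
    (subst (ℚ._≤ seq x (M ℕ.+ n)) (ℚ.+-identityˡ δ)
      (h (M ℕ.+ n) (ℕ.m≤m+n M n))))))))
  (p≤p+q (seq (inv x (δ , 0<δ , M , h)) n) (ℚ.<⇒≤ 0<γ))

-- Natural numbers, powers and logarithms

-- Normalised fractions with variable entries do not compute, so identities between them are checked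
-- on unnormalised fractions and carried over.
fromℚᵘ-homo-+ : ∀ p q → ℚ.fromℚᵘ (p ℚᵘ.+ q) ≡ ℚ.fromℚᵘ p ℚ.+ ℚ.fromℚᵘ q
fromℚᵘ-homo-+ p q = ℚ.toℚᵘ-injective (begin
  ℚ.toℚᵘ (ℚ.fromℚᵘ (p ℚᵘ.+ q))
    ≈⟨ ℚ.toℚᵘ-fromℚᵘ (p ℚᵘ.+ q) ⟩
  p ℚᵘ.+ q
    ≈⟨ ℚᵘ.+-cong (ℚ.toℚᵘ-fromℚᵘ p) (ℚ.toℚᵘ-fromℚᵘ q) ⟨
  ℚ.toℚᵘ (ℚ.fromℚᵘ p) ℚᵘ.+ ℚ.toℚᵘ (ℚ.fromℚᵘ q)
    ≈⟨ ℚ.toℚᵘ-homo-+ (ℚ.fromℚᵘ p) (ℚ.fromℚᵘ q) ⟨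
  ℚ.toℚᵘ (ℚ.fromℚᵘ p ℚ.+ ℚ.fromℚᵘ q) ∎)
  where open import Relation.Binary.Reasoning.Setoid ℚᵘ.≃-setoid

fromℚᵘ-homo-* : ∀ p q → ℚ.fromℚᵘ (p ℚᵘ.* q) ≡ ℚ.fromℚᵘ p ℚ.* ℚ.fromℚᵘ q
fromℚᵘ-homo-* p q = ℚ.toℚᵘ-injective (begin
  ℚ.toℚᵘ (ℚ.fromℚᵘ (p ℚᵘ.* q))
    ≈⟨ ℚ.toℚᵘ-fromℚᵘ (p ℚᵘ.* q) ⟩
  p ℚᵘ.* q
    ≈⟨ ℚᵘ.*-cong (ℚ.toℚᵘ-fromℚᵘ p) (ℚ.toℚᵘ-fromℚᵘ q) ⟨
  ℚ.toℚᵘ (ℚ.fromℚᵘ p) ℚᵘ.* ℚ.toℚᵘ (ℚ.fromℚᵘ q)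
    ≈⟨ ℚ.toℚᵘ-homo-* (ℚ.fromℚᵘ p) (ℚ.fromℚᵘ q) ⟨
  ℚ.toℚᵘ (ℚ.fromℚᵘ p ℚ.* ℚ.fromℚᵘ q) ∎)
  where open import Relation.Binary.Reasoning.Setoid ℚᵘ.≃-setoid

/1-homo-+ : ∀ m n → + (m ℕ.+ n) ℚ./ 1 ≡ (+ m ℚ./ 1) ℚ.+ (+ n ℚ./ 1)
/1-homo-+ m n = trans
  (ℚ.fromℚᵘ-cong {mkℚᵘ (+ (m ℕ.+ n)) 0} {mkℚᵘ (+ m) 0 ℚᵘ.+ mkℚᵘ (+ n) 0}
    (ℚᵘ.*≡* (cong (ℤ._* + 1) (cong₂ ℤ._+_
      (sym (ℤ.*-identityʳ (+ m))) (sym (ℤ.*-identityʳ (+ n)))))))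
  (fromℚᵘ-homo-+ (mkℚᵘ (+ m) 0) (mkℚᵘ (+ n) 0))

/1-homo-* : ∀ m n → + (m ℕ.* n) ℚ./ 1 ≡ (+ m ℚ./ 1) ℚ.* (+ n ℚ./ 1)
/1-homo-* m n = trans
  (ℚ.fromℚᵘ-cong {mkℚᵘ (+ (m ℕ.* n)) 0} {mkℚᵘ (+ m) 0 ℚᵘ.* mkℚᵘ (+ n) 0}
    (ℚᵘ.*≡* (cong (ℤ._* + 1) (ℤ.pos-* m n))))
  (fromℚᵘ-homo-* (mkℚᵘ (+ m) 0) (mkℚᵘ (+ n) 0))

denominator-* : ∀ r → (+ ℚ.denominatorℕ r ℚ./ 1) ℚ.* r ≡ ℚ.numerator r ℚ./ 1
denominator-* r@(mkℚ a d-1 _) = trans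
  (cong ((+ suc d-1 ℚ./ 1) ℚ.*_) (sym (ℚ.fromℚᵘ-toℚᵘ r)))
  (trans (sym (fromℚᵘ-homo-* (mkℚᵘ (+ suc d-1) 0) (mkℚᵘ a d-1)))
    (ℚ.fromℚᵘ-cong {mkℚᵘ (+ suc d-1) 0 ℚᵘ.* mkℚᵘ a d-1} {mkℚᵘ a 0}
      (ℚᵘ.*≡* (trans (ℤ.*-identityʳ (+ suc d-1 ℤ.* a))
        (trans (ℤ.*-comm (+ suc d-1) a)
          (cong (a ℤ.*_) (sym (ℤ.*-identityˡ (+ suc d-1)))))))))

fromℕ-nonneg : ∀ n → Nonneg (seq (fromℕ n))
fromℕ-nonneg n =
  fromℚ-nonneg (ℚ.nonNegative⁻¹ (+ n ℚ./ 1) {{ℚ.normalize-nonNeg n 1}})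

fromℕ-mono : ∀ m n → m ℕ.≤ n → fromℕ m ≤ fromℕ n
fromℕ-mono m n m≤n = ≤-by (fromℕ m) (fromℕ n) (fromℕ-nonneg (n ℕ.∸ m))
  λ _ → trans (cong (λ n → + n ℚ./ 1) (sym (ℕ.m+[n∸m]≡n m≤n)))
    (/1-homo-+ m (n ℕ.∸ m))

recip-nonneg : ∀ k .{{_ : NonZero k}} → Nonneg (seq (recip k))
recip-nonneg k =
  fromℚ-nonneg (ℚ.nonNegative⁻¹ (+ 1 ℚ./ k) {{ℚ.normalize-nonNeg 1 k}})

/1-*-recip : ∀ k .{{_ : NonZero k}} → (+ k ℚ./ 1) ℚ.* (+ 1 ℚ./ k) ≡ 1ℚ
/1-*-recip k@(suc k-1) = trans
  (sym (fromℚᵘ-homo-* (mkℚᵘ (+ k) 0) (mkℚᵘ (+ 1) k-1)))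
  (ℚ.fromℚᵘ-cong {mkℚᵘ (+ k) 0 ℚᵘ.* mkℚᵘ (+ 1) k-1} {mkℚᵘ (+ 1) 0}
    (ℚᵘ.*≡* (trans (ℤ.*-identityʳ (+ k ℤ.* + 1)) (trans (ℤ.*-comm (+ k) (+ 1))
      (cong (λ m → + 1 ℤ.* + m) (sym (ℕ.*-identityˡ k)))))))

^-homo-+ : ∀ x m n i →
  seq (x ^ (m ℕ.+ n)) i ≡ seq (x ^ m) i ℚ.* seq (x ^ n) i
^-homo-+ x zero    n i = sym (ℚ.*-identityˡ (seq (x ^ n) i))
^-homo-+ x (suc m) n i =
  trans (cong (seq x i ℚ.*_) (^-homo-+ x m n i))
    (sym (ℚ.*-assoc (seq x i) (seq (x ^ m) i) (seq (x ^ n) i)))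

^-^-assoc : ∀ x m n i → seq ((x ^ m) ^ n) i ≡ seq (x ^ (m ℕ.* n)) i
^-^-assoc x m zero    i = cong (λ k → seq (x ^ k) i) (sym (ℕ.*-zeroʳ m))
^-^-assoc x m (suc n) i = begin
  seq (x ^ m) i ℚ.* seq ((x ^ m) ^ n) i
    ≡⟨ cong (seq (x ^ m) i ℚ.*_) (^-^-assoc x m n i) ⟩
  seq (x ^ m) i ℚ.* seq (x ^ (m ℕ.* n)) i
    ≡⟨ ^-homo-+ x m (m ℕ.* n) i ⟨
  seq (x ^ (m ℕ.+ m ℕ.* n)) i
    ≡⟨ cong (λ k → seq (x ^ k) i) (sym (ℕ.*-suc m n)) ⟩
  seq (x ^ (m ℕ.* suc n)) i ∎
  where open ≡-Reasoning

^-distrib-* : ∀ x y n i →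
  seq ((x * y) ^ n) i ≡ seq (x ^ n) i ℚ.* seq (y ^ n) i
^-distrib-* x y zero    i = refl
^-distrib-* x y (suc n) i =
  trans (cong (seq x i ℚ.* seq y i ℚ.*_) (^-distrib-* x y n i))
    (solve 4 (λ x y a b → x :* y :* (a :* b) := x :* a :* (y :* b)) refl
      (seq x i) (seq y i) (seq (x ^ n) i) (seq (y ^ n) i))

1-nonneg : Nonneg (seq 1ℝ)
1-nonneg = fromℚ-nonneg (ℚ.<⇒≤ 0<1)

^-nonneg : ∀ x n → Nonneg (seq x) → Nonneg (seq (x ^ n))
^-nonneg x zero    0≤x = 1-nonneg
^-nonneg x (suc n) 0≤x = 0≤x ⊗ ^-nonneg x n 0≤x

≤-nonneg : ∀ x y → Nonneg (seq x) → x ≤ y → Nonneg (seq y)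
≤-nonneg x y 0≤x x≤y = 0≤⇒nonneg y (≤-by 0ℝ y (0≤x ⊕ diff x y x≤y)
  λ n → solve 2 (λ x y → y := con 0ℚ :+ (x :+ (y :- x))) refl
    (seq x n) (seq y n))

^-mono : ∀ x y n → Nonneg (seq x) → x ≤ y → x ^ n ≤ y ^ n
^-mono x y zero    0≤x x≤y = ≤-refl 1ℝ
^-mono x y (suc n) 0≤x x≤y = ≤-by (x ^ suc n) (y ^ suc n)
  (diff x y x≤y ⊗ ^-nonneg y n (≤-nonneg x y 0≤x x≤y)
    ⊕ 0≤x ⊗ diff (x ^ n) (y ^ n) (^-mono x y n 0≤x x≤y))
  λ i → solve 4 (λ x y a b →
      y :* b := x :* a :+ ((y :- x) :* b :+ x :* (b :- a))) refl
    (seq x i) (seq y i) (seq (x ^ n) i) (seq (y ^ n) i)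

-- Bounding the logarithm to base `φ` by the natural one, with `i` in the role of `1/ε`

module _ (e ℓ φ i L : ℝ) (2≤e : fromℕ 2 ≤ e) (e≤φ³ : e ≤ φ ^ 3)
         (0≤φ : Nonneg (seq φ)) (1≤i : 1ℝ ≤ i)
         (ℓ-log : IsLog e i ℓ) (L-log : IsLog φ (fromℕ 12 * i) L) where
  private
    0≤e = ≤-nonneg (fromℕ 2) e (fromℕ-nonneg 2) 2≤e
    0≤i = ≤-nonneg 1ℝ i 1-nonneg 1≤i

    -- `(2 i)^4` exceeds `12 i` by `16 i (i^3 - 1) + 4 i`, which is nonnegative for `i ≥ 1`; then
    -- `2 ≤ e` applies.
    12i≤[ei]⁴ : fromℕ 12 * i ≤ (e * i) ^ 4
    12i≤[ei]⁴ = ≤-trans (fromℕ 12 * i) ((fromℕ 2 * i) ^ 4) ((e * i) ^ 4)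
      (≤-by (fromℕ 12 * i) ((fromℕ 2 * i) ^ 4)
        (fromℕ-nonneg 16 ⊗ 0≤i ⊗ diff 1ℝ i 1≤i
            ⊗ (0≤i ⊗ 0≤i ⊕ 0≤i ⊕ 1-nonneg)
          ⊕ fromℕ-nonneg 4 ⊗ 0≤i)
        λ n → solve 1 (λ i → let 2i = con (+ 2 ℚ./ 1) :* i in
          2i :* (2i :* (2i :* (2i :* con 1ℚ))) :=
          con (+ 12 ℚ./ 1) :* i :+
            (con (+ 16 ℚ./ 1) :* i :* (i :- con 1ℚ)
                :* (i :* i :+ i :+ con 1ℚ)
              :+ con (+ 4 ℚ./ 1) :* i)) refl (seq i n))
      (^-mono (fromℕ 2 * i) (e * i) 4 (fromℕ-nonneg 2 ⊗ 0≤i)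
        (≤-by (fromℕ 2 * i) (e * i) (diff (fromℕ 2) e 2≤e ⊗ 0≤i)
          λ n → solve 3 (λ c e i → e :* i := c :* i :+ (e :- c) :* i) refl
            (+ 2 ℚ./ 1) (seq e n) (seq i n)))

  -- e^p ≤ φ^(3p) ≤ (12 i)^(3q) ≤ (e i)^(12q)
  change-of-base : ∀ p q → φ ^ p ≤ (fromℕ 12 * i) ^ q →
    e ^ p ≤ e ^ (4 ℕ.* q ℕ.* 3) * i ^ (4 ℕ.* q ℕ.* 3)
  change-of-base p q φᵖ≤ =
    ≤-trans (e ^ p) ((φ ^ p) ^ 3) (e ^ A * i ^ A)
      (≤-trans (e ^ p) ((φ ^ 3) ^ p) ((φ ^ p) ^ 3)
        (^-mono e (φ ^ 3) p 0≤e e≤φ³)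
        (≐⇒≤ ((φ ^ 3) ^ p) ((φ ^ p) ^ 3) λ n → trans (^-^-assoc φ 3 p n)
          (trans (cong (λ k → seq (φ ^ k) n) (ℕ.*-comm 3 p))
            (sym (^-^-assoc φ p 3 n)))))
      (≤-trans ((φ ^ p) ^ 3) ((((e * i) ^ 4) ^ q) ^ 3) (e ^ A * i ^ A)
        (^-mono (φ ^ p) (((e * i) ^ 4) ^ q) 3 (^-nonneg φ p 0≤φ)
          (≤-trans (φ ^ p) ((fromℕ 12 * i) ^ q) (((e * i) ^ 4) ^ q) φᵖ≤
            (^-mono (fromℕ 12 * i) ((e * i) ^ 4) q
              (fromℕ-nonneg 12 ⊗ 0≤i) 12i≤[ei]⁴)))
        (≐⇒≤ ((((e * i) ^ 4) ^ q) ^ 3) (e ^ A * i ^ A) λ n →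
          trans (^-^-assoc ((e * i) ^ 4) q 3 n)
            (trans (^-^-assoc (e * i) 4 (q ℕ.* 3) n)
              (trans (cong (λ k → seq ((e * i) ^ k) n)
                       (sym (ℕ.*-assoc 4 q 3)))
                (^-distrib-* e i A n)))))
    where A = 4 ℕ.* q ℕ.* 3

  -- `IsLog` at `p = r = 0`, `q = 1` translates `1 ≤ i`.
  log-nonneg : Nonneg (seq ℓ)
  log-nonneg = 0≤⇒nonneg ℓ (≤-trans 0ℝ (fromℕ 0 + fromℕ 1 * ℓ) ℓ
    (Equivalence.to (ℓ-log 0 0 1)
      (≤-by 1ℝ (e ^ 0 * i ^ 1) (diff 1ℝ i 1≤i)
        λ n → solve 1 (λ i → con 1ℚ :* (i :* con 1ℚ) :=
          con 1ℚ :+ (i :- con 1ℚ)) refl (seq i n)))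
    (≐⇒≤ (fromℕ 0 + fromℕ 1 * ℓ) ℓ λ n →
      solve 1 (λ l → con 0ℚ :+ con 1ℚ :* l := l) refl (seq ℓ n)))

  private
    Y = fromℕ 12 * (1ℝ + ℓ)

    0≤Y : Nonneg (seq Y)
    0≤Y = fromℕ-nonneg 12 ⊗ (1-nonneg ⊕ log-nonneg)

    -- With `r = p/q`, `r ≤ L` means `φ^p ≤ (12 i)^q`. Changing the base gives `e^p ≤ e^A i^A` for
    -- `A = 12 q`, that is `p ≤ 12 q (1 + ℓ)`. Positivity of `r` makes the numerator a natural
    -- exponent.
    below-log : ∀ r → 0ℝ < fromℚ r → fromℚ r ≤ L → fromℚ r ≤ Y
    below-log (mkℚ -[1+ a ] d-1 c) 0<r r≤L = contradiction
      (fromℚ-mono (ℚ.<⇒≤ (ℚ.negative⁻¹ (mkℚ -[1+ a ] d-1 c))))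
      (<⇒≱ 0ℝ (fromℚ (mkℚ -[1+ a ] d-1 c)) 0<r)
    below-log r@(mkℚ (+ p) d-1 _) 0<r r≤L = ≤-by (fromℚ r) Y
      (recip-nonneg q ⊗ diff (fromℕ p) (fromℕ A + fromℕ A * ℓ) p≤)
      λ n → trans (sym (trans
          (cong (ℚ._* (c ℚ.* (1ℚ ℚ.+ seq ℓ n))) (/1-*-recip q))
          (ℚ.*-identityˡ _)))
        (trans (expand (+ q ℚ./ 1) (+ 1 ℚ./ q) c (seq ℓ n) r)
          (cong₂ (λ u v → u ℚ.+ (+ 1 ℚ./ q) ℚ.* v)
            (trans (cong (ℚ._* r) (/1-*-recip q)) (ℚ.*-identityˡ r))
            (cong₂ (λ a p → a ℚ.+ a ℚ.* seq ℓ n ℚ.- p)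
              (sym A≡) (denominator-* r))))
      where
      q = suc d-1
      A = 4 ℕ.* q ℕ.* 3
      c = + 12 ℚ./ 1

      A≡ : + A ℚ./ 1 ≡ c ℚ.* (+ q ℚ./ 1)
      A≡ = trans (cong (λ k → + k ℚ./ 1)
          (trans (ℕ.*-comm (4 ℕ.* q) 3) (sym (ℕ.*-assoc 3 4 q))))
        (/1-homo-* 12 q)

      -- The ring solver treats `q` and its reciprocal `s` as unrelated, so the factor `q s`, equal
      -- to 1, is inserted by hand.
      expand : ∀ q s c l r →
        q ℚ.* s ℚ.* (c ℚ.* (1ℚ ℚ.+ l)) ≡
        q ℚ.* s ℚ.* r ℚ.+ s ℚ.* (c ℚ.* q ℚ.+ c ℚ.* q ℚ.* l ℚ.- q ℚ.* r)
      expand = solve 5 (λ q s c l r →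
        q :* s :* (c :* (con 1ℚ :+ l)) :=
        q :* s :* r :+ s :* (c :* q :+ c :* q :* l :- q :* r)) refl

      φᵖ≤ : φ ^ p ≤ (fromℕ 12 * i) ^ q
      φᵖ≤ = ≤-trans (φ ^ p) (1ℝ * (fromℕ 12 * i) ^ q) ((fromℕ 12 * i) ^ q)
        (Equivalence.from (L-log p 0 q)
          (≤-by (fromℕ p) (fromℕ 0 + fromℕ q * L)
            (fromℕ-nonneg q ⊗ diff (fromℚ r) L r≤L)
            λ n → trans
              (solve 3 (λ q l r → con 0ℚ :+ q :* l := q :* r :+ q :* (l :- r))
                refl (+ q ℚ./ 1) (seq L n) r)
              (cong (ℚ._+ (+ q ℚ./ 1) ℚ.* (seq L n ℚ.- r)) (denominator-* r))))
        (≐⇒≤ (1ℝ * (fromℕ 12 * i) ^ q) ((fromℕ 12 * i) ^ q) λ n →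
          ℚ.*-identityˡ (seq ((fromℕ 12 * i) ^ q) n))

      p≤ : fromℕ p ≤ fromℕ A + fromℕ A * ℓ
      p≤ = Equivalence.to (ℓ-log p A A) (change-of-base p q φᵖ≤)

  -- `IsLog` compares `L` with rationals only, so a gap `Y < L` is refuted through a rational inside
  -- it, which is positive because `Y` is nonnegative.
  log-bound : L ≤ Y
  log-bound = ≮⇒≥ Y L λ Y<L →
    let r , Y<r , r≤L = rational-between Y L Y<L in
    <⇒≱ Y (fromℚ r) Y<r
      (below-log r (≤-<-trans 0ℝ Y (fromℚ r) (Nonneg.0≤ 0≤Y) Y<r) r≤L)

-- The golden ratio

-- What the analysis uses of the golden ratio: `φ+1≤φ²` prices a swap, `9≤8φ` amounts to
-- `9 (φ - 1) ≥ φ` and accounts for the constant 9, `4≤φ³` serves the change of base, and `φ≤2`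
-- makes the logarithm at least 1.
record IsGolden (φ : ℝ) : Set where
  field
    φ-nonneg : Nonneg (seq φ)
    9≤8φ     : fromℕ 9 ≤ fromℕ 8 * φ
    φ≤2      : φ ≤ fromℕ 2
    φ+1≤φ²   : φ + 1ℝ ≤ φ * φ
    4≤φ³     : fromℕ 4 ≤ φ ^ 3

  φ-1-nonneg : Nonneg (seq (φ - 1ℝ))
  φ-1-nonneg = diff 1ℝ φ (≤-by 1ℝ φ
    (fromℚ-nonneg (ℚ.nonNegative⁻¹ (+ 1 ℚ./ 8))
      ⊕ fromℚ-nonneg (ℚ.nonNegative⁻¹ (+ 1 ℚ./ 8))
        ⊗ diff (fromℕ 9) (fromℕ 8 * φ) 9≤8φ)
    λ n → solve 1 (λ x → x := con 1ℚ :+ (con (+ 1 ℚ./ 8) :+ con (+ 1 ℚ./ 8)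
      :* (con (+ 8 ℚ./ 1) :* x :- con (+ 9 ℚ./ 1)))) refl (seq φ n))

fromℕ-<-suc : ∀ n → fromℕ n < fromℕ (suc n)
fromℕ-<-suc n = 1ℚ , 0<1 , 0 , λ _ _ → ℚ.≤-reflexive
  (trans (ℚ.+-comm (+ n ℚ./ 1) 1ℚ) (sym (/1-homo-+ 1 n)))

-- The bounds rest on `2 ≤ s ≤ 3` and the identities `φ² - φ - 1 = (s² - 5)/4` and
-- `φ³ - 4 = (3 + s)(s² - 5)/8 + (s - 2)`.
golden-isGolden : ∀ s → IsSqrt (fromℕ 5) s → IsGolden (golden s)
golden-isGolden s (0≤s , s²≤5 , 5≤s²) = record
  { φ-nonneg = (1-nonneg ⊕ s-nonneg) ⊗ recip-nonneg 2
  ; 9≤8φ = ≤-by (fromℕ 9) (fromℕ 8 * φ)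
      (fromℕ-nonneg 4 ⊗ 0≤s-2 ⊕ fromℕ-nonneg 3)
      λ n → solve 1 (λ s → con (+ 8 ℚ./ 1) :* ((con 1ℚ :+ s) :* con ℚ.½) :=
        con (+ 9 ℚ./ 1) :+ (con (+ 4 ℚ./ 1) :* (s :- con (+ 2 ℚ./ 1))
          :+ con (+ 3 ℚ./ 1))) refl (seq s n)
  ; φ≤2 = ≤-by φ (fromℕ 2) (recip-nonneg 2 ⊗ diff s (fromℕ 3) s≤3)
      λ n → solve 1 (λ s → con (+ 2 ℚ./ 1) := (con 1ℚ :+ s) :* con ℚ.½
        :+ con ℚ.½ :* (con (+ 3 ℚ./ 1) :- s)) refl (seq s n)
  ; φ+1≤φ² = ≤-by (φ + 1ℝ) (φ * φ) (recip-nonneg 4 ⊗ 0≤s²-5)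
      λ n → solve 1 (λ s → let φ = (con 1ℚ :+ s) :* con ℚ.½ in
        φ :* φ := φ :+ con 1ℚ
          :+ con (+ 1 ℚ./ 4) :* (s :* s :- con (+ 5 ℚ./ 1))) refl (seq s n)
  ; 4≤φ³ = ≤-by (fromℕ 4) (φ ^ 3)
      (recip-nonneg 8 ⊗ (fromℕ-nonneg 3 ⊕ s-nonneg) ⊗ 0≤s²-5 ⊕ 0≤s-2)
      λ n → solve 1 (λ s → let φ = (con 1ℚ :+ s) :* con ℚ.½ in
        φ :* (φ :* (φ :* con 1ℚ)) := con (+ 4 ℚ./ 1)
          :+ (con (+ 1 ℚ./ 8) :* (con (+ 3 ℚ./ 1) :+ s)
                :* (s :* s :- con (+ 5 ℚ./ 1))
              :+ (s :- con (+ 2 ℚ./ 1)))) refl (seq s n)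
  }
  where
  φ = golden s
  s-nonneg = 0≤⇒nonneg s 0≤s

  2≤s : fromℕ 2 ≤ s
  2≤s = ≰⇒≥ s (fromℕ 2) λ s≤2 → <⇒≱ (fromℕ 4) (fromℕ 5) (fromℕ-<-suc 4)
    (≤-by (fromℕ 5) (fromℕ 4)
      (diff s (fromℕ 2) s≤2 ⊗ (fromℕ-nonneg 2 ⊕ s-nonneg)
        ⊕ diff (fromℕ 5) (s * s) 5≤s²)
      λ n → solve 1 (λ s → con (+ 4 ℚ./ 1) := con (+ 5 ℚ./ 1)
        :+ ((con (+ 2 ℚ./ 1) :- s) :* (con (+ 2 ℚ./ 1) :+ s)
            :+ (s :* s :- con (+ 5 ℚ./ 1)))) refl (seq s n))

  s≤3 : s ≤ fromℕ 3
  -- `3 ≤ s` would give `9 ≤ s² ≤ 5`; padding the right side by 3 yields `9 ≤ 8`, which a comparison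
  -- of consecutive naturals refutes.
  s≤3 = ≰⇒≥ (fromℕ 3) s λ 3≤s → <⇒≱ (fromℕ 8) (fromℕ 9) (fromℕ-<-suc 8)
    (≤-by (fromℕ 9) (fromℕ 8)
      (diff (fromℕ 3) s 3≤s ⊗ (s-nonneg ⊕ fromℕ-nonneg 3)
        ⊕ diff (s * s) (fromℕ 5) s²≤5 ⊕ fromℕ-nonneg 3)
      λ n → solve 1 (λ s → con (+ 8 ℚ./ 1) := con (+ 9 ℚ./ 1)
        :+ ((s :- con (+ 3 ℚ./ 1)) :* (s :+ con (+ 3 ℚ./ 1))
            :+ (con (+ 5 ℚ./ 1) :- s :* s) :+ con (+ 3 ℚ./ 1)))
        refl (seq s n))

  0≤s-2 = diff (fromℕ 2) s 2≤s
  0≤s²-5 = diff (fromℕ 5) (s * s) 5≤s²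

-- Finite subsets and prefixes of the arrival order

x∈p∪q∪r⁺ : ∀ {n} {x : Fin n} p q r → x ∈ r → x ∈ p ∪ (q ∪ r)
x∈p∪q∪r⁺ p q r x∈r = q⊆p∪q p (q ∪ r) (q⊆p∪q q r x∈r)

p⊆⁅x⁆∪p─⁅x⁆ : ∀ {n} x (p : Subset n) → p ⊆ ⁅ x ⁆ ∪ (p ─ ⁅ x ⁆)
p⊆⁅x⁆∪p─⁅x⁆ x p {y} y∈p with y Fin.≟ x
... | yes refl = p⊆p∪q (p ─ ⁅ x ⁆) (x∈⁅x⁆ x)
... | no  y≢x  = q⊆p∪q ⁅ x ⁆ (p ─ ⁅ x ⁆) (x∈p∧x≢y⇒x∈p-y y∈p y≢x)

x∈p⇒⁅x⁆∪p≡p : ∀ {n} {x : Fin n} {p} → x ∈ p → ⁅ x ⁆ ∪ p ≡ p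
x∈p⇒⁅x⁆∪p≡p {x = x} {p} x∈p = ⊆-antisym
  (λ y∈ → [ (λ y∈⁅x⁆ → subst (_∈ p) (sym (x∈⁅y⁆⇒x≡y x y∈⁅x⁆)) x∈p)
          , (λ y∈p → y∈p) ]′ (x∈p∪q⁻ ⁅ x ⁆ p y∈))
  (q⊆p∪q ⁅ x ⁆ p)

x∈p⇒⁅x⁆∪p─⁅x⁆≡p : ∀ {n} {x : Fin n} {p} → x ∈ p → ⁅ x ⁆ ∪ (p ─ ⁅ x ⁆) ≡ p
x∈p⇒⁅x⁆∪p─⁅x⁆≡p {x = x} {p} x∈p = ⊆-antisym
  (λ y∈ → [ (λ y∈⁅x⁆ → subst (_∈ p) (sym (x∈⁅y⁆⇒x≡y x y∈⁅x⁆)) x∈p)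
          , p─q⊆p p ⁅ x ⁆ ]′ (x∈p∪q⁻ ⁅ x ⁆ (p ─ ⁅ x ⁆) y∈))
  (p⊆⁅x⁆∪p─⁅x⁆ x p)

x∈p─q⇒x∉q : ∀ {n} {x : Fin n} p q → x ∈ p ─ q → x ∉ q
x∈p─q⇒x∉q (_      ∷ p) (_       ∷ q) (there x∈) (there x∈q) = x∈p─q⇒x∉q p q x∈ x∈q
x∈p─q⇒x∉q (_      ∷ p) (inside  ∷ q) () here

∣p∪q∣≤∣p∣+∣q∣ : ∀ {n} (p q : Subset n) → ∣ p ∪ q ∣ ℕ.≤ ∣ p ∣ ℕ.+ ∣ q ∣
∣p∪q∣≤∣p∣+∣q∣ []            []            = z≤n
∣p∪q∣≤∣p∣+∣q∣ (outside ∷ p) (outside ∷ q) = ∣p∪q∣≤∣p∣+∣q∣ p q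
∣p∪q∣≤∣p∣+∣q∣ (outside ∷ p) (inside  ∷ q) =
  ℕ.≤-trans (s≤s (∣p∪q∣≤∣p∣+∣q∣ p q)) (ℕ.≤-reflexive (sym (ℕ.+-suc ∣ p ∣ ∣ q ∣)))
∣p∪q∣≤∣p∣+∣q∣ (inside  ∷ p) (outside ∷ q) = s≤s (∣p∪q∣≤∣p∣+∣q∣ p q)
∣p∪q∣≤∣p∣+∣q∣ (inside  ∷ p) (inside  ∷ q) = s≤s (ℕ.≤-trans (∣p∪q∣≤∣p∣+∣q∣ p q)
  (ℕ.+-monoʳ-≤ ∣ p ∣ (ℕ.n≤1+n ∣ q ∣)))

-- Keeping the reference set `r` fixed lets the cost of successive swaps add up over a round.
p⊆⁅x⁆∪q⇒∣p─r∣≤1+∣q─r∣ : ∀ {n} x (p q r : Subset n) → p ⊆ ⁅ x ⁆ ∪ q →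
  ∣ p ─ r ∣ ℕ.≤ suc ∣ q ─ r ∣
p⊆⁅x⁆∪q⇒∣p─r∣≤1+∣q─r∣ x p q r p⊆ = ℕ.≤-trans
  (p⊆q⇒∣p∣≤∣q∣ {p = p ─ r} {q = ⁅ x ⁆ ∪ (q ─ r)} λ y∈ →
    [ p⊆p∪q (q ─ r)
    , (λ y∈q → q⊆p∪q ⁅ x ⁆ (q ─ r)
        (x∈p∧x∉q⇒x∈p─q y∈q (x∈p─q⇒x∉q p r y∈))) ]′
    (x∈p∪q⁻ ⁅ x ⁆ q (p⊆ (p─q⊆p p r y∈))))
  (ℕ.≤-trans (∣p∪q∣≤∣p∣+∣q∣ ⁅ x ⁆ (q ─ r))
    (ℕ.≤-reflexive (cong (ℕ._+ ∣ q ─ r ∣) (∣⁅x⁆∣≡1 x))))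

∣p─p∣≡0 : ∀ {n} (p : Subset n) → ∣ p ─ p ∣ ≡ 0
∣p─p∣≡0 []            = refl
∣p─p∣≡0 (outside ∷ p) = ∣p─p∣≡0 p
∣p─p∣≡0 (inside  ∷ p) = ∣p─p∣≡0 p

module _ {n} (P : Subset n → Set) (P⊥ : P ⊥)
         (P-insert : ∀ x p → x ∈ p → P (p ─ ⁅ x ⁆) → P p) where

  -- Recursion on a bound for the cardinality, since `p ─ ⁅ x ⁆` is not a structural part of `p`.
  subset-induction : ∀ p → P p
  subset-induction p = go ∣ p ∣ p ℕ.≤-refl
    where
    go : ∀ m p → ∣ p ∣ ℕ.≤ m → P p
    go m p ∣p∣≤m with nonempty? p
    go m p ∣p∣≤m | no empty = subst P (sym (Empty-unique empty)) P⊥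
    go zero p ∣p∣≤0 | yes (x , x∈p) = contradiction
      (ℕ.<-≤-trans (x∈p⇒∣p-x∣<∣p∣ x∈p) ∣p∣≤0) (λ ())
    go (suc m) p ∣p∣≤1+m | yes (x , x∈p) = P-insert x p x∈p
      (go m (p ─ ⁅ x ⁆)
        (ℕ.s≤s⁻¹ (ℕ.<-≤-trans (x∈p⇒∣p-x∣<∣p∣ x∈p) ∣p∣≤1+m)))

∈-prefix⁻ : ∀ {n} (π : Permutation′ n) t {x} → x ∈ prefix π t → toℕ (π ⟨$⟩ˡ x) ℕ.< t
∈-prefix⁻ π t {x} x∈ = go (toℕ (π ⟨$⟩ˡ x) ℕ.<? t)
  (trans (sym (lookup∘tabulate _ x)) ([]=⇒lookup x∈))
  where
  go : ∀ {A : Set} (A? : Dec A) → does A? ≡ true → A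
  go (yes a) _ = a

∈-prefix⁺ : ∀ {n} (π : Permutation′ n) t {x} → toℕ (π ⟨$⟩ˡ x) ℕ.< t → x ∈ prefix π t
∈-prefix⁺ π t {x} x<t = lookup⇒[]= x (prefix π t)
  (trans (lookup∘tabulate _ x) (dec-true (toℕ (π ⟨$⟩ˡ x) ℕ.<? t) x<t))

prefix-zero : ∀ {n} (π : Permutation′ n) {x} → x ∉ prefix π 0
prefix-zero π x∈ with () ← ∈-prefix⁻ π 0 x∈

prefix-suc : ∀ {n} (π : Permutation′ n) (i : Fin n) {x} →
  x ∈ prefix π (suc (toℕ i)) → x ∈ prefix π (toℕ i) ⊎ x ≡ π ⟨$⟩ʳ i
prefix-suc π i {x} x∈ with toℕ (π ⟨$⟩ˡ x) ℕ.<? toℕ i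
... | yes x<i = inj₁ (∈-prefix⁺ π (toℕ i) x<i)
... | no  x≮i = inj₂ (trans (sym (inverseʳ π)) (cong (π ⟨$⟩ʳ_)
  (Fin.toℕ-injective (ℕ.≤-antisym
    (ℕ.s≤s⁻¹ (∈-prefix⁻ π (suc (toℕ i)) x∈)) (ℕ.≮⇒≥ x≮i)))))

-- Analysis of the algorithm

module Analysis
  {n} (φ : ℝ) (φ-golden : IsGolden φ) (k : ℕ) .{{_ : NonZero k}}
  (f : Subset n → ℝ) (f-mns : MonotoneNormalizedSubmodular f)
  (N : ℕ) (π : Permutation′ n) where

  open Algorithm φ k f N π
  open IsGolden φ-golden
  open MonotoneNormalizedSubmodular f-mns using (monotone; submodular)

  private
    c = recip k

    0≤f : ∀ X → Nonneg (seq (f X))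
    0≤f X = 0≤⇒nonneg (f X) (MonotoneNormalizedSubmodular.nonneg f-mns X)

    0≤c : Nonneg (seq c)
    0≤c = recip-nonneg k

  -- `monotone` handles one element at a time, so `Z ∪ X` is built up by induction on `Z`; at
  -- `Z = Y` it equals `Y`.
  f-mono : ∀ {X} Y → X ⊆ Y → f X ≤ f Y
  f-mono {X} Y X⊆Y = subst (λ Z → f X ≤ f Z)
    (⊆-antisym (λ x∈ → [ (λ x∈Y → x∈Y) , X⊆Y ]′ (x∈p∪q⁻ Y X x∈)) (p⊆p∪q X))
    (subset-induction (λ Z → f X ≤ f (Z ∪ X))
      (subst (λ Z → f X ≤ f Z) (sym (∪-identityˡ X)) (≤-refl (f X)))
      (λ x Z x∈Z fX≤ → ≤-trans (f X) (f ((Z ─ ⁅ x ⁆) ∪ X)) (f (Z ∪ X)) fX≤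
        (subst (λ W → f ((Z ─ ⁅ x ⁆) ∪ X) ≤ f W)
          (trans (sym (∪-assoc ⁅ x ⁆ (Z ─ ⁅ x ⁆) X))
            (cong (_∪ X) (x∈p⇒⁅x⁆∪p─⁅x⁆≡p x∈Z)))
          (≤-insert x ((Z ─ ⁅ x ⁆) ∪ X))))
      Y)
    where
    ≤-insert : ∀ x Z → f Z ≤ f (⁅ x ⁆ ∪ Z)
    ≤-insert x Z = ≤-by (f Z) (f (⁅ x ⁆ ∪ Z))
      (0≤⇒nonneg (marginal f ⁅ x ⁆ Z) (monotone Z x))
      λ n → solve 2 (λ a b → b := a :+ (b :- a)) refl
        (seq (f Z) n) (seq (f (⁅ x ⁆ ∪ Z)) n)

  -- Submodularity freed of the condition `x ∉ Y`: if `x ∈ Y`, nothing is added and the marginal is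
  -- nonnegative.
  insert-≤ : ∀ x X Y → X ⊆ Y → f (⁅ x ⁆ ∪ Y) ≤ f Y + marginal f ⁅ x ⁆ X
  insert-≤ x X Y X⊆Y with x ∈? Y
  ... | yes x∈Y = subst (λ Z → f Z ≤ f Y + marginal f ⁅ x ⁆ X)
    (sym (x∈p⇒⁅x⁆∪p≡p x∈Y))
    (≤-by (f Y) (f Y + marginal f ⁅ x ⁆ X)
      (0≤⇒nonneg (marginal f ⁅ x ⁆ X) (monotone X x)) λ _ → refl)
  ... | no x∉Y = ≤-by (f (⁅ x ⁆ ∪ Y)) (f Y + marginal f ⁅ x ⁆ X)
    (diff (marginal f ⁅ x ⁆ Y) (marginal f ⁅ x ⁆ X) (submodular X⊆Y x∉Y))
    λ n → solve 3 (λ a b m → b :+ m := a :+ (m :- (a :- b))) refl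
      (seq (f (⁅ x ⁆ ∪ Y)) n) (seq (f Y) n) (seq (marginal f ⁅ x ⁆ X) n)

  LocalOpt : Subset n → Subset n → Set
  LocalOpt V S = ¬ (∃[ x ] (x ∈ V × Improves x S))

  private
    threshold : Subset n → ℝ
    threshold S = φ * c * f S

    0≤threshold : ∀ S → Nonneg (seq (threshold S))
    0≤threshold S = φ-nonneg ⊗ 0≤c ⊗ 0≤f S

  -- Adding the elements of `O` one by one, each contributes at most its marginal over `S`, which at
  -- a local optimum is at most the threshold.
  LocalOpt-union : ∀ V S → LocalOpt V S → ∀ O m → ∣ O ∣ ℕ.≤ m → O ⊆ V →
    f (O ∪ S) ≤ f S + fromℕ m * threshold S
  LocalOpt-union V S opt = subset-induction Bound empty extend
    where
    Bound : Subset n → Set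
    Bound O = ∀ m → ∣ O ∣ ℕ.≤ m → O ⊆ V → f (O ∪ S) ≤ f S + fromℕ m * threshold S

    empty : Bound ⊥
    empty m _ _ = subst (λ Z → f Z ≤ f S + fromℕ m * threshold S)
      (sym (∪-identityˡ S))
      (≤-by (f S) (f S + fromℕ m * threshold S)
        (fromℕ-nonneg m ⊗ 0≤threshold S) λ _ → refl)

    extend : ∀ x O → x ∈ O → Bound (O ─ ⁅ x ⁆) → Bound O
    extend x O x∈O bound zero ∣O∣≤0 O⊆V = contradiction
      (ℕ.<-≤-trans (x∈p⇒∣p-x∣<∣p∣ x∈O) ∣O∣≤0) (λ ())
    extend x O x∈O bound (suc m) ∣O∣≤1+m O⊆V =
      ≤-by (f (O ∪ S)) (f S + fromℕ (suc m) * threshold S)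
        (diff (f (O ∪ S)) (f (O′ ∪ S) + μ) O-step
          ⊕ diff (f (O′ ∪ S)) (f S + fromℕ m * threshold S)
              (bound m ∣O′∣≤m (λ y∈ → O⊆V (p─q⊆p O ⁅ x ⁆ y∈)))
          ⊕ diff μ (threshold S)
              (≰⇒≥ (threshold S) μ λ improves → opt (x , O⊆V x∈O , improves)))
        λ n → trans
          (cong (λ a → seq (f S) n ℚ.+ a ℚ.* seq (threshold S) n) (/1-homo-+ 1 m))
          (solve 6 (λ s m t μ o o′ →
            s :+ (con 1ℚ :+ m) :* t :=
            o :+ ((o′ :+ μ :- o) :+ (s :+ m :* t :- o′) :+ (t :- μ))) refl
            (seq (f S) n) (+ m ℚ./ 1) (seq (threshold S) n) (seq μ n)
            (seq (f (O ∪ S)) n) (seq (f (O′ ∪ S)) n))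
      where
      O′ = O ─ ⁅ x ⁆
      μ = marginal f ⁅ x ⁆ S

      ∣O′∣≤m : ∣ O′ ∣ ℕ.≤ m
      ∣O′∣≤m = ℕ.s≤s⁻¹ (ℕ.<-≤-trans (x∈p⇒∣p-x∣<∣p∣ x∈O) ∣O∣≤1+m)

      O-step : f (O ∪ S) ≤ f (O′ ∪ S) + μ
      O-step = subst (λ Z → f Z ≤ f (O′ ∪ S) + μ)
        (trans (sym (∪-assoc ⁅ x ⁆ O′ S)) (cong (_∪ S) (x∈p⇒⁅x⁆∪p─⁅x⁆≡p x∈O)))
        (insert-≤ x S (O′ ∪ S) (q⊆p∪q O′ S))

  -- Effect of a single swap

  MinSwap-⊆ : ∀ {S x S′} → MinSwap S x S′ → S′ ⊆ ⁅ x ⁆ ∪ S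
  MinSwap-⊆ {S} {x} (insert _) = ⊆-reflexive (∪-comm S ⁅ x ⁆)
  MinSwap-⊆ {S} {x} (exchange r _ _ _) y∈ =
    [ (λ y∈S─r → q⊆p∪q ⁅ x ⁆ S (p─q⊆p S ⁅ r ⁆ y∈S─r)) , p⊆p∪q S ]′
      (x∈p∪q⁻ (S ─ ⁅ r ⁆) ⁅ x ⁆ y∈)

  -- An exchange loses at most `f(S)/k` by dropping `r`, and by submodularity `x` adds at least as
  -- much to `S ─ ⁅ r ⁆` as to `S`. A plain insertion loses nothing.
  MinSwap-gain : ∀ {S x S′} → MinSwap S x S′ →
    f S + marginal f ⁅ x ⁆ S ≤ f S′ + f S * c
  MinSwap-gain {S} {x} (insert _) = subst
    (λ Z → f S + marginal f ⁅ x ⁆ S ≤ f Z + f S * c) (∪-comm ⁅ x ⁆ S)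
    (≤-by (f S + marginal f ⁅ x ⁆ S) (f (⁅ x ⁆ ∪ S) + f S * c) (0≤f S ⊗ 0≤c)
      λ n → solve 3 (λ s s′ c → s′ :+ s :* c := s :+ (s′ :- s) :+ s :* c) refl
        (seq (f S) n) (seq (f (⁅ x ⁆ ∪ S)) n) (seq c n))
  MinSwap-gain {S} {x} (exchange r _ r∈S light) = subst
    (λ Z → f S + marginal f ⁅ x ⁆ S ≤ f Z + f S * c) (∪-comm ⁅ x ⁆ R)
    (≤-by (f S + marginal f ⁅ x ⁆ S) (f (⁅ x ⁆ ∪ R) + f S * c)
      (diff (f (⁅ x ⁆ ∪ S)) (f S + marginal f ⁅ x ⁆ R)
          (insert-≤ x R S (p─q⊆p S ⁅ r ⁆))
        ⊕ diff (f S - f R) (f S * c)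
            (subst (λ Z → f Z - f R ≤ f S * c) (x∈p⇒⁅x⁆∪p─⁅x⁆≡p r∈S) light))
      λ n → solve 5 (λ s xs r xr c →
        xr :+ s :* c := s :+ (xs :- s)
          :+ ((s :+ (xr :- r) :- xs) :+ (s :* c :- (s :- r)))) refl
        (seq (f S) n) (seq (f (⁅ x ⁆ ∪ S)) n) (seq (f R) n)
        (seq (f (⁅ x ⁆ ∪ R)) n) (seq c n))
    where R = S ─ ⁅ r ⁆

  swap-growth : ∀ {S x S′} → Improves x S → MinSwap S x S′ →
    f S + (φ - 1ℝ) * c * f S ≤ f S′
  swap-growth {S} {x} {S′} improves sw =
    ≤-by (f S + (φ - 1ℝ) * c * f S) (f S′)
      (diff (f S + μ) (f S′ + f S * c) (MinSwap-gain sw)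
        ⊕ diff (threshold S) μ improves)
      λ n → solve 5 (λ s s′ φ c μ →
        s′ := s :+ (φ :- con 1ℚ) :* c :* s
          :+ ((s′ :+ s :* c :- (s :+ μ)) :+ (μ :- φ :* c :* s))) refl
        (seq (f S) n) (seq (f S′) n) (seq φ n) (seq c n) (seq μ n)
    where μ = marginal f ⁅ x ⁆ S

  -- The gain of a swap is at least the fraction 1 − 1/φ = 1/φ² of the marginal
  -- value of the new element.
  swap-marginal : ∀ {S x S′} → Improves x S → MinSwap S x S′ →
    marginal f ⁅ x ⁆ S ≤ (φ + 1ℝ) * (f S′ - f S)
  swap-marginal {S} {x} {S′} improves sw =
    ≤-by μ ((φ + 1ℝ) * (f S′ - f S))
      ((φ-nonneg ⊕ 1-nonneg)
          ⊗ diff (f S + μ) (f S′ + f S * c) (MinSwap-gain sw)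
        ⊕ φ-nonneg ⊗ diff (threshold S) μ improves
        ⊕ 0≤c ⊗ 0≤f S ⊗ diff (φ + 1ℝ) (φ * φ) φ+1≤φ²)
      λ n → solve 5 (λ s s′ φ c μ →
        (φ :+ con 1ℚ) :* (s′ :- s) := μ
          :+ ((φ :+ con 1ℚ) :* (s′ :+ s :* c :- (s :+ μ))
              :+ φ :* (μ :- φ :* c :* s)
              :+ c :* s :* (φ :* φ :- (φ :+ con 1ℚ)))) refl
        (seq (f S) n) (seq (f S′) n) (seq φ n) (seq c n) (seq μ n)
    where μ = marginal f ⁅ x ⁆ S

  -- `b` is the debt left by rejected arrivals. Bounding `f (O ∪ T)` rather than `f O` keeps
  -- discarded elements in the union, so a swap enlarges it by the new element only, and `S ⊆ T`
  -- bounds that increase by a marginal over `S`.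
  record Covered (V S : Subset n) (b : ℝ) : Set where
    constructor covered-by
    field
      T     : Subset n
      S⊆T   : S ⊆ T
      cover : ∀ O → O ⊆ V → ∣ O ∣ ℕ.≤ k → f (O ∪ T) ≤ (φ + 1ℝ) * f S + b

  Covered-mono : ∀ {V S b} b′ → b ≤ b′ → Covered V S b → Covered V S b′
  Covered-mono {S = S} {b} b′ b≤b′ (covered-by T S⊆T cover) =
    covered-by T S⊆T λ O O⊆V ∣O∣≤k →
    ≤-trans (f (O ∪ T)) ((φ + 1ℝ) * f S + b) ((φ + 1ℝ) * f S + b′)
      (cover O O⊆V ∣O∣≤k)
      (≤-by ((φ + 1ℝ) * f S + b) ((φ + 1ℝ) * f S + b′) (diff b b′ b≤b′)
        λ n → solve 3 (λ a b b′ → a :+ b′ := a :+ b :+ (b′ :- b)) refl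
          ((seq φ n ℚ.+ 1ℚ) ℚ.* seq (f S) n) (seq b n) (seq b′ n))

  -- Covers both an arrival of `x` and an unchanged set, so that arrivals and local steps share the
  -- lemmas below.
  Extends : Subset n → Fin n → Subset n → Set
  Extends V x V′ = ∀ {y} → y ∈ V′ → y ∈ V ⊎ y ≡ x

  private
    remove-⊆ : ∀ {V V′ x} → Extends V x V′ → ∀ O → O ⊆ V′ → O ─ ⁅ x ⁆ ⊆ V
    remove-⊆ {x = x} V′⊆ O O⊆V′ y∈ = [ (λ y∈V → y∈V)
      , (λ { refl → contradiction (x∈⁅x⁆ x) (x∈p─q⇒x∉q O ⁅ x ⁆ y∈) }) ]′
      (V′⊆ (O⊆V′ (p─q⊆p O ⁅ x ⁆ y∈)))

    -- Removing `x` from `O` leaves a set feasible before the arrival of `x`; putting it back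
    -- through `T` costs one marginal.
    union-step : ∀ x S T O → S ⊆ T →
      f (O ∪ (⁅ x ⁆ ∪ T)) ≤ f ((O ─ ⁅ x ⁆) ∪ T) + marginal f ⁅ x ⁆ S
    union-step x S T O S⊆T =
      ≤-trans (f (O ∪ (⁅ x ⁆ ∪ T))) (f (⁅ x ⁆ ∪ (O′ ∪ T)))
        (f (O′ ∪ T) + marginal f ⁅ x ⁆ S)
        (f-mono (⁅ x ⁆ ∪ (O′ ∪ T)) λ y∈ →
          [ (λ y∈O → subst (_ ∈_) (∪-assoc ⁅ x ⁆ O′ T)
              (p⊆p∪q T (p⊆⁅x⁆∪p─⁅x⁆ x O y∈O)))
          , (λ y∈ → [ p⊆p∪q (O′ ∪ T) , x∈p∪q∪r⁺ ⁅ x ⁆ O′ T ]′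
              (x∈p∪q⁻ ⁅ x ⁆ T y∈)) ]′
          (x∈p∪q⁻ O (⁅ x ⁆ ∪ T) y∈))
        (insert-≤ x S (O′ ∪ T) (λ y∈S → q⊆p∪q O′ T (S⊆T y∈S)))
      where O′ = O ─ ⁅ x ⁆

  -- `x` joins `T`, and `swap-marginal` pays for it out of the growth of `(φ + 1) f(S)`, so no debt
  -- arises.
  Covered-swap : ∀ {V V′ S x S′ b} → Extends V x V′ → Improves x S → MinSwap S x S′ →
    Covered V S b → Covered V′ S′ b
  Covered-swap {S = S} {x} {S′} {b} V′⊆ improves sw (covered-by T S⊆T cover) =
    covered-by (⁅ x ⁆ ∪ T)
      (λ y∈S′ → [ p⊆p∪q T , (λ y∈S → q⊆p∪q ⁅ x ⁆ T (S⊆T y∈S)) ]′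
        (x∈p∪q⁻ ⁅ x ⁆ S (MinSwap-⊆ sw y∈S′)))
      λ O O⊆V′ ∣O∣≤k → let O′ = O ─ ⁅ x ⁆ in
      ≤-by (f (O ∪ (⁅ x ⁆ ∪ T))) ((φ + 1ℝ) * f S′ + b)
        (diff (f (O ∪ (⁅ x ⁆ ∪ T))) (f (O′ ∪ T) + μ) (union-step x S T O S⊆T)
          ⊕ diff (f (O′ ∪ T)) ((φ + 1ℝ) * f S + b)
              (cover O′ (remove-⊆ V′⊆ O O⊆V′) (ℕ.≤-trans (∣p─q∣≤∣p∣ O ⁅ x ⁆) ∣O∣≤k))
          ⊕ diff μ ((φ + 1ℝ) * (f S′ - f S)) (swap-marginal improves sw))
        λ n → solve 7 (λ o o′ μ φ s s′ b →
          (φ :+ con 1ℚ) :* s′ :+ b := o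
            :+ ((o′ :+ μ :- o) :+ ((φ :+ con 1ℚ) :* s :+ b :- o′)
                :+ ((φ :+ con 1ℚ) :* (s′ :- s) :- μ))) refl
          (seq (f (O ∪ (⁅ x ⁆ ∪ T))) n) (seq (f (O′ ∪ T)) n) (seq μ n) (seq φ n)
          (seq (f S) n) (seq (f S′) n) (seq b n)
    where μ = marginal f ⁅ x ⁆ S

  -- `T` stays, but `O` may now contain `x`, whose marginal over `S` is at most the threshold.
  Covered-reject : ∀ {V V′ S x b} → Extends V x V′ → ¬ Improves x S →
    Covered V S b → Covered V′ S (b + threshold S)
  Covered-reject {S = S} {x} {b} V′⊆ ¬improves (covered-by T S⊆T cover) =
    covered-by T S⊆T λ O O⊆V′ ∣O∣≤k → let O′ = O ─ ⁅ x ⁆ in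
      ≤-by (f (O ∪ T)) ((φ + 1ℝ) * f S + (b + threshold S))
        (diff (f (O ∪ T)) (f (O ∪ (⁅ x ⁆ ∪ T)))
            (f-mono (O ∪ (⁅ x ⁆ ∪ T)) λ y∈ →
              [ p⊆p∪q (⁅ x ⁆ ∪ T) , x∈p∪q∪r⁺ O ⁅ x ⁆ T ]′ (x∈p∪q⁻ O T y∈))
          ⊕ diff (f (O ∪ (⁅ x ⁆ ∪ T))) (f (O′ ∪ T) + μ) (union-step x S T O S⊆T)
          ⊕ diff (f (O′ ∪ T)) ((φ + 1ℝ) * f S + b)
              (cover O′ (remove-⊆ V′⊆ O O⊆V′) (ℕ.≤-trans (∣p─q∣≤∣p∣ O ⁅ x ⁆) ∣O∣≤k))
          ⊕ diff μ (threshold S) (≰⇒≥ (threshold S) μ ¬improves))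
        λ n → solve 7 (λ o o″ o′ μ s b t →
          s :+ (b :+ t) := o
            :+ ((o″ :- o) :+ (o′ :+ μ :- o″) :+ (s :+ b :- o′) :+ (t :- μ))) refl
          (seq (f (O ∪ T)) n) (seq (f (O ∪ (⁅ x ⁆ ∪ T))) n) (seq (f (O′ ∪ T)) n)
          (seq μ n) (seq ((φ + 1ℝ) * f S) n) (seq b n) (seq (threshold S) n)
    where μ = marginal f ⁅ x ⁆ S

  -- `T` restarts at `S`; as `k` times `1/k` is 1, the `k` thresholds add up to `φ f(S)`.
  Covered-LocalOpt : ∀ {V S} → LocalOpt V S → Covered V S 0ℝ
  Covered-LocalOpt {V} {S} opt = covered-by S ⊆-refl λ O O⊆V ∣O∣≤k →
    ≤-trans (f (O ∪ S)) (f S + fromℕ k * threshold S) ((φ + 1ℝ) * f S + 0ℝ)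
      (LocalOpt-union V S opt O k ∣O∣≤k O⊆V)
      (≐⇒≤ (f S + fromℕ k * threshold S) ((φ + 1ℝ) * f S + 0ℝ) λ n → trans
        (solve 4 (λ k c φ s → s :+ k :* (φ :* c :* s) := s :+ (k :* c) :* (φ :* s))
          refl (+ k ℚ./ 1) (seq c n) (seq φ n) (seq (f S) n))
        (trans (cong (λ a → seq (f S) n ℚ.+ a ℚ.* (seq φ n ℚ.* seq (f S) n))
            (/1-*-recip k))
          (solve 2 (λ φ s → s :+ con 1ℚ :* (φ :* s) :=
            (φ :+ con 1ℚ) :* s :+ con 0ℚ) refl (seq φ n) (seq (f S) n))))

  swap-≤ : ∀ {S x S′} → Improves x S → MinSwap S x S′ → f S ≤ f S′
  swap-≤ {S} {x} {S′} improves sw =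
    ≤-trans (f S) (f S + (φ - 1ℝ) * c * f S) (f S′)
      (≤-by (f S) (f S + (φ - 1ℝ) * c * f S)
        (φ-1-nonneg ⊗ 0≤c ⊗ 0≤f S) λ _ → refl)
      (swap-growth improves sw)

  -- A local optimum reached in the middle of a round is therefore still present at its end.
  LocalOpt-fixed : ∀ {V m S S′} → LocalOpt V S → LocalSteps V m S S′ → S′ ≡ S
  LocalOpt-fixed opt done = refl
  LocalOpt-fixed opt (step (swap x x∈V improves _) _) =
    contradiction (x , x∈V , improves) opt
  LocalOpt-fixed opt (step (stay _) steps) = LocalOpt-fixed opt steps

  -- A single `stay` certifies a local optimum; otherwise all `m` steps are swaps and their gains
  -- accumulate.
  LocalSteps-outcome : ∀ {V m S S′ b} → LocalSteps V m S S′ → Covered V S b →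
    LocalOpt V S′ ⊎
    (Covered V S′ b × f S + fromℕ m * ((φ - 1ℝ) * c * f S) ≤ f S′)
  LocalSteps-outcome {S = S} done covered =
    inj₂ (covered , ≐⇒≤ (f S + fromℕ 0 * ((φ - 1ℝ) * c * f S)) (f S) λ n →
      solve 2 (λ s a → s :+ con 0ℚ :* a := s) refl
        (seq (f S) n) (seq ((φ - 1ℝ) * c * f S) n))
  LocalSteps-outcome {V} (step (stay opt) steps) covered =
    inj₁ (subst (LocalOpt V) (sym (LocalOpt-fixed opt steps)) opt)
  LocalSteps-outcome {V} {suc m} {S} {S″} {b}
    (step {S′ = S′} (swap x x∈V improves sw) steps) covered =
    [ inj₁ , (λ (covered′ , growth) → inj₂ (covered′ , accumulate growth)) ]′
      (LocalSteps-outcome steps (Covered-swap inj₁ improves sw covered))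
    where
    κ = (φ - 1ℝ) * c
    accumulate : f S′ + fromℕ m * ((φ - 1ℝ) * c * f S′) ≤ f S″ →
      f S + fromℕ (suc m) * ((φ - 1ℝ) * c * f S) ≤ f S″
    accumulate growth =
      ≤-trans (f S + fromℕ (suc m) * (κ * f S))
        (f S + (1ℝ + fromℕ m) * (κ * f S)) (f S″)
        (≐⇒≤ (f S + fromℕ (suc m) * (κ * f S)) (f S + (1ℝ + fromℕ m) * (κ * f S))
          λ n → cong (λ a → seq (f S) n ℚ.+ a ℚ.* seq (κ * f S) n) (/1-homo-+ 1 m))
        -- Later gains are proportional to `f S′`; the third summand lowers them to `f S`, giving
        -- linear growth.
        (≤-by (f S + (1ℝ + fromℕ m) * (κ * f S)) (f S″)
          (diff (f S′ + fromℕ m * (κ * f S′)) (f S″) growth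
            ⊕ diff (f S + κ * f S) (f S′) (swap-growth improves sw)
            ⊕ fromℕ-nonneg m ⊗ (φ-1-nonneg ⊗ 0≤c)
              ⊗ diff (f S) (f S′) (swap-≤ improves sw))
          λ n → solve 5 (λ s s′ s″ m κ →
            s″ := s :+ (con 1ℚ :+ m) :* (κ :* s)
              :+ (s″ :- (s′ :+ m :* (κ :* s′)) :+ (s′ :- (s :+ κ :* s))
                :+ m :* κ :* (s′ :- s))) refl
            (seq (f S) n) (seq (f S′) n) (seq (f S″) n) (+ m ℚ./ 1) (seq κ n))

  -- An accepted arrival keeps the debt at `b`; allowing the larger debt in both cases makes the
  -- rest of the round uniform.
  Covered-arrival : ∀ {V V′ S x S′ b} → Extends V x V′ → Arrival x S S′ →
    Covered V S b → Covered V′ S′ (b + threshold S) × f S ≤ f S′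
  Covered-arrival {S = S} {b = b} V′⊆ (accept improves sw) covered =
    Covered-mono (b + threshold S)
      (≤-by b (b + threshold S) (0≤threshold S) λ _ → refl)
      (Covered-swap V′⊆ improves sw covered)
    , swap-≤ improves sw
  Covered-arrival {S = S} V′⊆ (reject ¬improves) covered =
    Covered-reject V′⊆ ¬improves covered , ≤-refl (f S)

  -- Approximation guarantee over a whole run

  module _ (ε : ℝ) (0≤ε : Nonneg (seq ε)) (1≤εN : 1ℝ ≤ ε * fromℕ N) where
    private
      slack : Subset n → ℝ
      slack S = fromℕ 9 * ε * f S

      0≤slack : ∀ S → Nonneg (seq (slack S))
      0≤slack S = fromℕ-nonneg 9 ⊗ 0≤ε ⊗ 0≤f S

    -- The slack grows by at least `9 ε N (φ - 1)/k` times `f(S)`. Since `ε N ≥ 1` and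
    -- `9 (φ - 1) ≥ φ`, this is at least the threshold.
    slack-growth : ∀ S S′ S″ → f S ≤ f S′ →
      f S′ + fromℕ N * ((φ - 1ℝ) * c * f S′) ≤ f S″ →
      slack S + threshold S ≤ slack S″
    slack-growth S S′ S″ S≤S′ growth =
      ≤-by (slack S + threshold S) (slack S″)
        (fromℕ-nonneg 9 ⊗ 0≤ε
            ⊗ diff (f S′ + fromℕ N * ((φ - 1ℝ) * c * f S′)) (f S″) growth
          ⊕ fromℕ-nonneg 9 ⊗ 0≤ε ⊗ diff (f S) (f S′) S≤S′
            ⊗ (1-nonneg ⊕ fromℕ-nonneg N ⊗ (φ-1-nonneg ⊗ 0≤c))
          ⊕ fromℕ-nonneg 9 ⊗ φ-1-nonneg ⊗ 0≤c ⊗ 0≤f S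
            ⊗ diff 1ℝ (ε * fromℕ N) 1≤εN
          ⊕ diff (fromℕ 9) (fromℕ 8 * φ) 9≤8φ ⊗ 0≤c ⊗ 0≤f S)
        λ n → solve 7 (λ s s′ s″ φ c ε N → let nine = con (+ 9 ℚ./ 1) in
          nine :* ε :* s″ := nine :* ε :* s :+ φ :* c :* s
            :+ (nine :* ε :* (s″ :- (s′ :+ N :* ((φ :- con 1ℚ) :* c :* s′)))
              :+ nine :* ε :* (s′ :- s)
                :* (con 1ℚ :+ N :* ((φ :- con 1ℚ) :* c))
              :+ nine :* (φ :- con 1ℚ) :* c :* s :* (ε :* N :- con 1ℚ)
              :+ (con (+ 8 ℚ./ 1) :* φ :- nine) :* c :* s)) refl
          (seq (f S) n) (seq (f S′) n) (seq (f S″) n) (seq φ n) (seq c n)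
          (seq ε n) (+ N ℚ./ 1)

    -- Either a local optimum clears the debt, or the growth over `N` swaps absorbs the debt of the
    -- arrival.
    Covered-round : ∀ {V V′ S x S′ S″} → Extends V x V′ → Arrival x S S′ →
      LocalSteps V′ N S′ S″ → Covered V S (slack S) → Covered V′ S″ (slack S″)
    Covered-round {S = S} {S′ = S′} {S″} V′⊆ arrival steps covered =
      let covered′ , S≤S′ = Covered-arrival V′⊆ arrival covered in
      [ (λ opt → Covered-mono (slack S″)
          (≤-by 0ℝ (slack S″) (0≤slack S″)
            λ n → sym (ℚ.+-identityˡ (seq (slack S″) n)))
          (Covered-LocalOpt opt))
      , (λ (covered″ , growth) → Covered-mono (slack S″)
          (slack-growth S S′ S″ S≤S′ growth) covered″) ]′
      (LocalSteps-outcome steps covered′)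

    slack-cover : ∀ S → f S ≤ (φ + 1ℝ) * f S + slack S
    slack-cover S = ≤-by (f S) ((φ + 1ℝ) * f S + slack S)
      (φ-nonneg ⊗ 0≤f S ⊕ 0≤slack S)
      λ n → solve 3 (λ φ s b → (φ :+ con 1ℚ) :* s :+ b := s :+ (φ :* s :+ b))
        refl (seq φ n) (seq (f S) n) (seq (slack S) n)

    Covered-run : ∀ {S} → IsRun S → ∀ i → Covered (prefix π (toℕ i)) (S i) (slack (S i))
    Covered-run {S} run = <-weakInduction P base λ i covered →
      let _ , arrival , steps = round i in
      Covered-round {prefix π (toℕ i)} {prefix π (suc (toℕ i))} {S (inject₁ i)}
        {π ⟨$⟩ʳ i} {S″ = S (Fin.suc i)} (prefix-suc π i) arrival steps
        -- `toℕ (inject₁ i)` equals `toℕ i` only propositionally.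
        (subst (λ t → Covered (prefix π t) (S (inject₁ i)) (slack (S (inject₁ i))))
          (Fin.toℕ-inject₁ i) covered)
      where
      open IsRun run
      P : Fin (suc n) → Set
      P i = Covered (prefix π (toℕ i)) (S i) (slack (S i))
      base : P Fin.zero
      -- Nothing has arrived, so `O` is empty and `O ∪ S Fin.zero` lies in `S Fin.zero`.
      base = covered-by (S Fin.zero) ⊆-refl λ O O⊆∅ _ →
        ≤-trans (f (O ∪ S Fin.zero)) (f (S Fin.zero))
          ((φ + 1ℝ) * f (S Fin.zero) + slack (S Fin.zero))
          (f-mono (S Fin.zero) λ y∈ →
            [ (λ y∈O → contradiction (O⊆∅ y∈O) (prefix-zero π))
            , (λ y∈S → y∈S) ]′ (x∈p∪q⁻ O (S Fin.zero) y∈))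
          (slack-cover (S Fin.zero))

    approximation : ∀ {S} → IsRun S → ∀ i O → IsOPT f k (prefix π (toℕ i)) O →
      f O ≤ (φ + 1ℝ + fromℕ 9 * ε) * f (S i)
    approximation {S} run i O (O⊆V , ∣O∣≤k , _) =
      let covered-by T _ cover = Covered-run run i in
      ≤-trans (f O) (f (O ∪ T)) ((φ + 1ℝ + fromℕ 9 * ε) * f (S i))
        (f-mono (O ∪ T) (p⊆p∪q T))
        (≤-trans (f (O ∪ T)) ((φ + 1ℝ) * f (S i) + slack (S i))
          ((φ + 1ℝ + fromℕ 9 * ε) * f (S i))
          (cover O O⊆V ∣O∣≤k)
          (≐⇒≤ ((φ + 1ℝ) * f (S i) + slack (S i))
            ((φ + 1ℝ + fromℕ 9 * ε) * f (S i)) λ n →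
            solve 4 (λ φ nine ε s → (φ :+ con 1ℚ) :* s :+ nine :* ε :* s :=
              (φ :+ con 1ℚ :+ nine :* ε) :* s) refl
              (seq φ n) (+ 9 ℚ./ 1) (seq ε n) (seq (f (S i)) n)))

  -- Number of elements changed in a round

  LocalSteps-change : ∀ {V m S S′} → LocalSteps V m S S′ → ∀ A →
    ∣ S′ ─ A ∣ ℕ.≤ m ℕ.+ ∣ S ─ A ∣
  LocalSteps-change done A = ℕ.≤-refl
  LocalSteps-change {m = suc m} (step (stay _) steps) A =
    ℕ.≤-trans (LocalSteps-change steps A) (ℕ.n≤1+n _)
  LocalSteps-change {m = suc m} {S} (step {S′ = S′} (swap x _ _ sw) steps) A =
    ℕ.≤-trans (LocalSteps-change steps A) (ℕ.≤-trans
      (ℕ.+-monoʳ-≤ m (p⊆⁅x⁆∪q⇒∣p─r∣≤1+∣q─r∣ x S′ S A (MinSwap-⊆ sw)))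
      (ℕ.≤-reflexive (ℕ.+-suc m ∣ S ─ A ∣)))

  Arrival-change : ∀ {x S S′} → Arrival x S S′ → ∣ S′ ─ S ∣ ℕ.≤ 1
  Arrival-change {x} {S} {S′} (accept _ sw) = ℕ.≤-trans
    (p⊆⁅x⁆∪q⇒∣p─r∣≤1+∣q─r∣ x S′ S S (MinSwap-⊆ sw))
    (ℕ.≤-reflexive (cong suc (∣p─p∣≡0 S)))
  Arrival-change {S = S} (reject _) =
    ℕ.≤-trans (ℕ.≤-reflexive (∣p─p∣≡0 S)) z≤n

  run-change : ∀ {S} → IsRun S → ∀ i →
    ∣ S (Fin.suc i) ─ S (inject₁ i) ∣ ℕ.≤ suc N
  run-change {S} run i =
    let _ , arrival , steps = IsRun.round run i in
    ℕ.≤-trans (LocalSteps-change steps (S (inject₁ i)))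
      (ℕ.≤-trans (ℕ.+-monoʳ-≤ N (Arrival-change arrival))
        (ℕ.≤-reflexive (ℕ.+-comm N 1)))

-- Number of iterations per round

-- The case `n = 1` of the defining bounds.
Euler-bounds : ∀ e → IsEuler e → fromℕ 2 ≤ e × e ≤ fromℕ 4
Euler-bounds e euler =
    ≤-trans (fromℕ 2) ((1ℝ + recip 1) ^ 1) e
      (≐⇒≤ (fromℕ 2) ((1ℝ + recip 1) ^ 1) λ _ → refl) (proj₁ (euler 1))
  , ≤-trans e ((1ℝ + recip 1) ^ 2) (fromℕ 4)
      (proj₂ (euler 1)) (≐⇒≤ ((1ℝ + recip 1) ^ 2) (fromℕ 4) λ _ → refl)

module _ (ε : ℝ) (0<ε : 0ℝ < ε) (ε<1 : ε < 1ℝ) where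
  private
    i = inv ε 0<ε

    0≤ε : Nonneg (seq ε)
    0≤ε = 0≤⇒nonneg ε (<⇒≤ 0ℝ ε 0<ε)

    0≤i : Nonneg (seq i)
    0≤i = 0≤⇒nonneg i (0≤inv ε 0<ε)

  1≤inv : 1ℝ ≤ inv ε 0<ε
  1≤inv = ≤-by 1ℝ i
    (0≤i ⊗ diff ε 1ℝ (<⇒≤ ε 1ℝ ε<1)
      ⊕ diff 1ℝ (ε * i) (1≤*-inv ε 0<ε))
    λ n → solve 2 (λ ε i → i := con 1ℚ :+ (i :* (con 1ℚ :- ε)
      :+ (ε :* i :- con 1ℚ))) refl (seq ε n) (seq i n)

  -- `IsLog` at `p = q = 1`, `r = 0` translates `φ ≤ 2 ≤ 12/ε`.
  1≤log : ∀ φ L → φ ≤ fromℕ 2 → IsLog φ (fromℕ 12 * inv ε 0<ε) L → 1ℝ ≤ L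
  1≤log φ L φ≤2 L-log = ≤-trans 1ℝ (fromℕ 0 + fromℕ 1 * L) L
    (Equivalence.to (L-log 1 0 1)
      (≤-by (φ ^ 1) (φ ^ 0 * (fromℕ 12 * i) ^ 1)
        (diff φ (fromℕ 2) φ≤2 ⊕ fromℕ-nonneg 12 ⊗ diff 1ℝ i 1≤inv
          ⊕ fromℕ-nonneg 10)
        λ n → solve 2 (λ φ i → con 1ℚ :* (con (+ 12 ℚ./ 1) :* i :* con 1ℚ) :=
          φ :* con 1ℚ :+ (con (+ 2 ℚ./ 1) :- φ
            :+ con (+ 12 ℚ./ 1) :* (i :- con 1ℚ) :+ con (+ 10 ℚ./ 1))) refl
          (seq φ n) (seq i n)))
    (≐⇒≤ (fromℕ 0 + fromℕ 1 * L) L λ n →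
      solve 1 (λ l → con 0ℚ :+ con 1ℚ :* l := l) refl (seq L n))

  -- Multiplying the ceiling bound by `ε` gives `ε N ≥ L ≥ 1`.
  1≤ε*N : ∀ L N → 1ℝ ≤ L → inv ε 0<ε * L ≤ fromℕ N → 1ℝ ≤ ε * fromℕ N
  1≤ε*N L N 1≤L iL≤N = ≤-by 1ℝ (ε * fromℕ N)
    (0≤ε ⊗ diff (i * L) (fromℕ N) iL≤N
      ⊕ diff 1ℝ (ε * i) (1≤*-inv ε 0<ε) ⊗ ≤-nonneg 1ℝ L 1-nonneg 1≤L
      ⊕ diff 1ℝ L 1≤L)
    λ n → solve 4 (λ ε i L N → ε :* N := con 1ℚ :+ (ε :* (N :- i :* L)
      :+ (ε :* i :- con 1ℚ) :* L :+ (L :- con 1ℚ))) refl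
      (seq ε n) (seq i n) (seq L n) (+ N ℚ./ 1)

  -- 14 is 12 from the logarithm plus 2: one unit for the ceiling and one for the arrival, both at
  -- most `(1 + ℓ)/ε`.
  iterations-bound : ∀ L N ℓ → Nonneg (seq ℓ) → L ≤ fromℕ 12 * (1ℝ + ℓ) →
    fromℕ N < inv ε 0<ε * L + 1ℝ →
    fromℕ (suc N) ≤ fromℕ 14 * inv ε 0<ε * (1ℝ + ℓ) ^ 1
  iterations-bound L N ℓ 0≤ℓ L≤ N<iL+1 =
    ≤-trans (fromℕ (suc N)) (1ℝ + fromℕ N) (fromℕ 14 * i * (1ℝ + ℓ) ^ 1)
      (≐⇒≤ (fromℕ (suc N)) (1ℝ + fromℕ N) λ _ → /1-homo-+ 1 N)
      (≤-by (1ℝ + fromℕ N) (fromℕ 14 * i * (1ℝ + ℓ) ^ 1)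
        (diff (fromℕ N) (i * L + 1ℝ) (<⇒≤ (fromℕ N) (i * L + 1ℝ) N<iL+1)
          ⊕ 0≤i ⊗ diff L (fromℕ 12 * (1ℝ + ℓ)) L≤
          ⊕ fromℕ-nonneg 2 ⊗ (diff 1ℝ i 1≤inv ⊕ 0≤i ⊗ 0≤ℓ))
        λ n → solve 4 (λ N i L ℓ →
          con (+ 14 ℚ./ 1) :* i :* ((con 1ℚ :+ ℓ) :* con 1ℚ) :=
          con 1ℚ :+ N :+ ((i :* L :+ con 1ℚ :- N)
            :+ i :* (con (+ 12 ℚ./ 1) :* (con 1ℚ :+ ℓ) :- L)
            :+ con (+ 2 ℚ./ 1) :* (i :- con 1ℚ :+ i :* ℓ))) refl
          (+ N ℚ./ 1) (seq i n) (seq L n) (seq ℓ n))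

theorem5p2 : ∃[ c ] ∃[ d ] (0ℝ < c × 0 ℕ.< d ×
    (∀ (√5 : ℝ) → IsSqrt (fromℕ 5) √5 →
    let φ = golden √5 in
    ∀ (ε : ℝ) (0<ε : 0ℝ < ε) → ε < 1ℝ →
    ∀ (k : ℕ) .{{_ : NonZero k}} (n : ℕ) (f : Subset n → ℝ) →
    MonotoneNormalizedSubmodular f →
    ∀ (π : Permutation′ n) (L : ℝ) (N : ℕ) →
    IsLog φ (fromℕ 12 * inv ε 0<ε) L →
    IsCeil (inv ε 0<ε * L) N →
    ∀ (S : Fin (suc n) → Subset n) →
    Algorithm.IsRun φ k f N π S →
    (∀ (i : Fin n) (O : Subset n) →
    IsOPT f k (prefix π (suc (toℕ i))) O →
    (φ + 1ℝ + fromℕ 9 * ε) * f (S (Fin.suc i)) ≥ f O)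
    ×
    (∀ (e ℓ : ℝ) → IsEuler e → IsLog e (inv ε 0<ε) ℓ →
    ∀ (i : Fin n) → 2 ℕ.≤ suc (toℕ i) →
    fromℕ ∣ S (Fin.suc i) ─ S (inject₁ i) ∣
    ≤ c * inv ε 0<ε * (1ℝ + ℓ) ^ d)))
theorem5p2 = fromℕ 14 , 1 , 0<14 , s≤s z≤n ,
  λ √5 √5-sqrt ε 0<ε ε<1 k n f f-mns π L N L-log (iL≤N , N<iL+1) S run →
    let φ = golden √5
        φ-golden = golden-isGolden √5 √5-sqrt
        open IsGolden φ-golden
        open Analysis φ φ-golden k f f-mns N π
        1≤L = 1≤log ε 0<ε ε<1 φ L φ≤2 L-log
        1≤i = 1≤inv ε 0<ε ε<1
    -- Arrivals count from 0 and solutions from the empty `S Fin.zero`, so arrival `i` produces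
    -- `S (Fin.suc i)`, and `toℕ (Fin.suc i)` reduces to the prefix length of the statement.
    in (λ i O opt → approximation ε (0≤⇒nonneg ε (<⇒≤ 0ℝ ε 0<ε))
          (1≤ε*N ε 0<ε ε<1 L N 1≤L iL≤N) run (Fin.suc i) O opt)
     , (λ e ℓ euler ℓ-log i _ →
          let 2≤e , e≤4 = Euler-bounds e euler
              e≤φ³ = ≤-trans e (fromℕ 4) (φ ^ 3) e≤4 4≤φ³
              M = ∣ S (Fin.suc i) ─ S (inject₁ i) ∣
          in ≤-trans (fromℕ M) (fromℕ (suc N))
               (fromℕ 14 * inv ε 0<ε * (1ℝ + ℓ) ^ 1)
               (fromℕ-mono M (suc N) (run-change run i))
               (iterations-bound ε 0<ε ε<1 L N ℓ
                 (log-nonneg e ℓ φ (inv ε 0<ε) L 2≤e e≤φ³ φ-nonneg 1≤i ℓ-log L-log)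
                 (log-bound e ℓ φ (inv ε 0<ε) L 2≤e e≤φ³ φ-nonneg 1≤i ℓ-log L-log)
                 N<iL+1))
  where
  0<14 : 0ℝ < fromℕ 14
  0<14 = ≤-<-trans 0ℝ (fromℕ 13) (fromℕ 14) (fromℕ-mono 0 13 z≤n) (fromℕ-<-suc 13)
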